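{- Let $d\ge 2$ be fixed. For each sufficiently large $k$, there exists a (nonempty) family of $d$-dimensional $k\times\cdots\times k$ permutation matrices $P$ such that $I(P,d)=2^{\Omega(k^{1/d})}$. That is, there exist a constant $c>0$ and an integer $k_0$, depending only on $d$, such that for every $k\ge k_0$ there is a nonempty family of $d$-dimensional $k\times\cdots\times k$ permutation matrices, each member $P$ of which satisfies $I(P,d)\ge 2^{c\,k^{1/d}}$.
   Context: A $d$-dimensional $n_1\times\cdots\times n_d$ zero-one matrix is an array $A=(a_{i_1,\ldots,i_d})$, $1\le i_\ell\le n_\ell$, with entries in $\{0,1\}$. A submatrix is obtained by selecting, for each $\ell$, a set of values of the $\ell$-th coordinate (keeping the order). $A$ contains a $d$-dimensional zero-one matrix $B$ if some submatrix of $A$ can be transformed into $B$ by changing any number of ones to zeros; otherwise $A$ avoids $B$. $f(n,B,d)$ denotes the maximum number of ones in a $d$-dimensional $n\times\cdots\times n$ zero-one matrix that avoids $B$, and $$I(P,d)=\liminf_{n\to\infty}\frac{f(n,P,d)}{n^{d-1}}.$$ An $\ell$-cross section is the set of all entries having a fixed value of the $\ell$-th coordinate. A $d$-dimensional $k\times\cdots\times k$ zero-one matrix is a permutation matrix if each of its $\ell$-cross sections contains exactly one nonzero entry, for every $\ell=1,\ldots,d$. -}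

module Defs where

open import Level using (0ℓ)
open import Data.Bool using (Bool; true; false; if_then_else_)
import Data.Bool as Bool
import Data.Bool.Properties as Bool
open import Data.Nat using (ℕ; zero; suc; NonZero; _∸_; _≤_)
import Data.Nat as ℕ
open import Data.Nat.Properties using (m^n≢0)
open import Data.Integer using (ℤ; +_; -[1+_])
open import Data.Rational.Unnormalised using (ℚᵘ; 0ℚᵘ; _/_; ↥_; ↧ₙ_; +-*-rawSemiring)
import Data.Rational.Unnormalised as ℚ
open import Algebra.Definitions.RawSemiring +-*-rawSemiring using (_^_)
open import Data.Fin using (Fin)
import Data.Fin as Fin
open import Data.Fin.Properties using (any?; all?; _<?_)
open import Data.Vec using (Vec; []; _∷_; lookup; sum; map)
open import Data.Vec.Relation.Unary.All using (All)
import Data.Vec.Relation.Unary.All as All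
open import Data.List using (List; filter; cartesianProductWith)
import Data.List as List
open import Data.List.Extrema.Nat using (max)
open import Data.Product using (∃; ∃!; _×_; _,_)
open import Data.Sum using (_⊎_)
open import Relation.Nullary using (¬_; Dec; ¬?)
open import Relation.Nullary.Decidable using (map′; _×-dec_; _→-dec_)
open import Relation.Unary using (Pred; Decidable; _∈_)
open import Relation.Binary.PropositionalEquality using (_≡_)

private
  variable
    d n k : ℕ

-- The d-dimensional n × ⋯ × n zero-one matrices; true is one, false is zero.

Matrix : ℕ → ℕ → Set
Matrix zero    n = Bool
Matrix (suc d) n = Vec (Matrix d n) n

Index : ℕ → ℕ → Set
Index d n = Vec (Fin n) d

entry : Matrix d n → Index d n → Bool
entry A []       = A
entry A (i ∷ is) = entry (lookup A i) is

ones : ∀ d → Matrix d n → ℕ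
ones zero    b = if b then 1 else 0
ones (suc d) A = sum (map (ones d) A)

-- A set of k values of one coordinate is listed in increasing order, so
-- that a k × ⋯ × k submatrix is given by d increasing vectors.

Increasing : Vec (Fin n) k → Set
Increasing σ = ∀ i j → i Fin.< j → lookup σ i Fin.< lookup σ j

submatrix : Matrix d n → Vec (Vec (Fin n) k) d → Matrix d k
submatrix A []       = A
submatrix A (σ ∷ σs) = map (λ i → submatrix (lookup A i) σs) σ

-- B arises from A by changing ones to zeros.

_⊑_ : Matrix d n → Matrix d n → Set
_⊑_ {d} {n} B A = (i : Index d n) → entry B i Bool.≤ entry A i

Contains : Matrix d n → Matrix d k → Set
Contains {d} {n} {k} A B =
  ∃ λ (σs : Vec (Vec (Fin n) k) d) → All Increasing σs × B ⊑ submatrix A σs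

Avoids : Matrix d n → Matrix d k → Set
Avoids A B = ¬ Contains A B

-- The v-th ℓ-cross section is the set of entries whose index i has
-- lookup i ℓ ≡ v.

IsPermutation : Matrix d k → Set
IsPermutation {d} {k} P =
  (ℓ : Fin d) (v : Fin k) →
  ∃! _≡_ λ (i : Index d k) → lookup i ℓ ≡ v × entry P i ≡ true

Searchable : Set → Set₁
Searchable A = {P : Pred A 0ℓ} → Decidable P → Dec (∃ P)

anyVec? : {A : Set} → Searchable A → ∀ m → Searchable (Vec A m)
anyVec? s zero    P? = map′ (λ p → [] , p) (λ { ([] , p) → p }) (P? [])
anyVec? s (suc m) P? =
  map′ (λ { (x , xs , p) → x ∷ xs , p }) (λ { (x ∷ xs , p) → x , xs , p })
       (s λ x → anyVec? s m λ xs → P? (x ∷ xs))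

allIndices? : ∀ d {P : Pred (Index d n) 0ℓ} → Decidable P → Dec (∀ i → P i)
allIndices? zero    P? = map′ (λ { p [] → p }) (λ f → f []) (P? [])
allIndices? (suc d) P? =
  map′ (λ { f (x ∷ i) → f x i }) (λ f x i → f (x ∷ i))
       (all? λ x → allIndices? d λ i → P? (x ∷ i))

increasing? : Decidable (Increasing {n} {k})
increasing? σ = all? λ i → all? λ j → (i <? j) →-dec (lookup σ i <? lookup σ j)

contains? : (A : Matrix d n) (B : Matrix d k) → Dec (Contains A B)
contains? {d} {n} {k} A B =
  anyVec? (anyVec? any? k) d λ σs →
    All.all? increasing? σs ×-dec
    allIndices? d λ i → entry B i Bool.≤? entry (submatrix A σs) i

vectors : {A : Set} → List A → ∀ m → List (Vec A m)
vectors xs zero    = List.[ [] ]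
vectors xs (suc m) = cartesianProductWith _∷_ xs (vectors xs m)

matrices : ∀ d n → List (Matrix d n)
matrices zero    n = true List.∷ false List.∷ List.[]
matrices (suc d) n = vectors (matrices d n) n

-- If every n × ⋯ × n matrix contains B, the value is 0.

f : ∀ n → Matrix d k → ℕ
f {d} n B =
  max 0 (List.map (ones d) (filter (λ A → ¬? (contains? A B)) (matrices d n)))

-- Extended real numbers, as lower Dedekind cuts: a real number x is
-- represented by the set of all rationals q with q < x.

Cut : Set₁
Cut = Pred ℚᵘ 0ℓ

infix 4 _≼_
_≼_ : Cut → Cut → Set
x ≼ y = ∀ q → q ∈ x → q ∈ y

-- q < liminf x iff some rational r > q is eventually a lower bound of x.
-- The sequence is indexed by the positive integers.

liminf : ((n : ℕ) → .{{NonZero n}} → ℚᵘ) → Cut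
liminf x q =
  ∃ λ r → q ℚ.< r × ∃ λ N → ∀ n → .{{_ : NonZero n}} → N ≤ n → r ℚ.≤ x n

-- The d-th root of k, for d ≥ 1.

root : ℕ → ℕ → Cut
root d k q = q ℚ.< 0ℚᵘ ⊎ q ^ d ℚ.< + k / 1

-- Only meaningful for c > 0.

infixr 7 _·_
_·_ : ℚᵘ → Cut → Cut
(c · x) q = ∃ λ r → r ∈ x × q ℚ.< c ℚ.* r

2^ℤ : ℤ → ℚᵘ
2^ℤ (+ m)    = + (2 ℕ.^ m) / 1
2^ℤ -[1+ m ] = _/_ (+ 1) (2 ℕ.^ suc m) {{m^n≢0 2 (suc m)}}

-- For r = a / b the condition q < 2^r reads q < 0 or q^b < 2^a, and 2^x is
-- the supremum of 2^r over the rationals r < x.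

exp₂ : Cut → Cut
exp₂ x q = ∃ λ r → r ∈ x × (q ℚ.< 0ℚᵘ ⊎ q ^ ↧ₙ r ℚ.< 2^ℤ (↥ r))

I : Matrix d k → Cut
I {d} P = liminf λ n → _/_ (+ f n P) (n ℕ.^ (d ∸ 1)) {{m^n≢0 n (d ∸ 1)}}

{-# OPTIONS --safe #-}

-- A d-dimensional matrix P all of whose ones lie on the graph
-- (x, π x, x, …, x) of a two-dimensional permutation is avoided by A × [n]^(d-2)
-- whenever the matrix of π is avoided by A, so growth 2^Ω(√k) in dimension two
-- is enough.
--
-- There, π fixes 0 and transposes an ℓ × ℓ arrangement of ℓ² further points.
-- The one in the corner precedes all others, so copies of an N × N matrix along
-- an antidiagonal of blocks avoid π if that matrix does, and a matrix
-- containing π has an ℓ × ℓ all-ones interval minor.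
--
-- An N × N matrix without this minor, N = 2^r with ℓ = 40 r, comes from a random
-- table b of bits indexed by pairs of internal nodes of the binary tree over
-- [N]: entry (i , j) is one iff b is true on all ancestors of i times all
-- ancestors of j. An interval minor yields two rooted subtrees with ℓ nodes each
-- whose product b is true on. There are at most 2^(4ℓ + 2) pairs of such
-- subtrees, which the ℓ² bits per pair outweigh, while an entry depends on r²
-- bits only.

module Submission where

open import Defs
open import Level using (0ℓ)
open import Data.Bool using (Bool; true; false; _∧_; if_then_else_)
import Data.Bool as Bool
open import Data.Bool.Properties using (∧-conicalˡ; ∧-conicalʳ; T-≡)
open import Data.Fin as Fin using (Fin; zero; suc; toℕ; fromℕ<; combine; remQuot; splitAt; _↑ˡ_; _↑ʳ_)
import Data.Fin.Properties as Fin
open import Data.Integer as ℤ using (ℤ; -[1+_]; +≤+)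
import Data.Integer.Properties as ℤ
import Data.Integer.Tactic.RingSolver as ℤ
open import Data.List as List using (List; []; _∷_; length; filter; cartesianProductWith; applyUpTo; upTo)
open import Data.List.Extrema.Nat using (xs≤max)
open import Data.List.Membership.Propositional using (_∈_)
open import Data.List.Membership.Propositional.Properties using (∈-map⁺; ∈-filter⁺; ∈-cartesianProductWith⁺)
open import Data.List.Properties using
  (map-++; map-∘; map-upTo; length-map; length-++; length-filter; length-upTo; ++-assoc; ++-identityʳ)
open import Data.List.Relation.Unary.All as All using (All; []; _∷_)
open import Data.List.Relation.Unary.All.Properties using (all-filter) renaming (map⁺ to All-map⁺)
open import Data.List.Relation.Unary.Any using (here; there)
open import Data.Nat hiding (+-*-rawSemiring)
open import Data.Nat.Divisibility using (n∣m*n)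
open import Data.Nat.DivMod
open import Data.Nat.ListAction using (sum)
open import Data.Nat.ListAction.Properties using (sum-++)
open import Data.Nat.Properties
open import Data.Nat.Tactic.RingSolver using (solve-∀)
open import Data.Product using (∃; _×_; _,_; uncurry)
open import Data.Rational.Unnormalised as ℚ using (ℚᵘ; mkℚᵘ; 0ℚᵘ; ↥_; ↧ₙ_; *≤*; *<*; *≡*; +-*-rawSemiring)
import Data.Rational.Unnormalised.Properties as ℚ
open import Algebra.Definitions.RawSemiring +-*-rawSemiring using () renaming (_^_ to _^ℚ_)
open import Data.Sum using (inj₁; inj₂; [_,_]′)
open import Data.Vec as Vec using (Vec; []; _∷_; lookup)
import Data.Vec.Properties as Vec
open import Data.Vec.Relation.Unary.All using (_∷_)
open import Function using (_∘_; id; flip)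
open import Function.Bundles using (Equivalence)
open import Relation.Binary.PropositionalEquality
open import Relation.Nullary using (¬_; ¬?; yes; no; contradiction)
open import Relation.Nullary.Decidable using (isYes)
open import Relation.Unary as Unary using (Pred; Satisfiable)

-- Finite sums over lists and the enumeration of vectors.

∑ : {A : Set} → List A → (A → ℕ) → ℕ
∑ xs f = sum (List.map f xs)

module _ {A : Set} where

  ∑-cong : ∀ (xs : List A) {f g} → (∀ x → f x ≡ g x) → ∑ xs f ≡ ∑ xs g
  ∑-cong []       eq = refl
  ∑-cong (x ∷ xs) eq = cong₂ _+_ (eq x) (∑-cong xs eq)

  ∑-constant : ∀ {xs : List A} {f c} → All (λ x → f x ≡ c) xs → ∑ xs f ≡ length xs * c
  ∑-constant []         = refl
  ∑-constant (eq ∷ eqs) = cong₂ _+_ eq (∑-constant eqs)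

  ∑-const : ∀ (xs : List A) c → ∑ xs (λ _ → c) ≡ length xs * c
  ∑-const xs c = ∑-constant (All.universal (λ _ → refl) xs)

  ∑-mono : ∀ (xs : List A) {f g} → (∀ x → f x ≤ g x) → ∑ xs f ≤ ∑ xs g
  ∑-mono []       le = z≤n
  ∑-mono (x ∷ xs) le = +-mono-≤ (le x) (∑-mono xs le)

  ∑-+ : ∀ (xs : List A) f g → ∑ xs (λ x → f x + g x) ≡ ∑ xs f + ∑ xs g
  ∑-+ []       f g = refl
  ∑-+ (x ∷ xs) f g rewrite ∑-+ xs f g = interchange (f x) (g x) (∑ xs f) (∑ xs g)
    where
    interchange : ∀ a b c d → (a + b) + (c + d) ≡ (a + c) + (b + d)
    interchange = solve-∀

  ∑-*ˡ : ∀ (xs : List A) c f → ∑ xs (λ x → c * f x) ≡ c * ∑ xs f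
  ∑-*ˡ []       c f = sym (*-zeroʳ c)
  ∑-*ˡ (x ∷ xs) c f rewrite ∑-*ˡ xs c f = sym (*-distribˡ-+ c (f x) _)

  ∑-*ʳ : ∀ (xs : List A) c f → ∑ xs (λ x → f x * c) ≡ ∑ xs f * c
  ∑-*ʳ []       c f = refl
  ∑-*ʳ (x ∷ xs) c f rewrite ∑-*ʳ xs c f = sym (*-distribʳ-+ c (f x) _)

  ∈⇒≤∑ : ∀ {xs : List A} {x} f → x ∈ xs → f x ≤ ∑ xs f
  ∈⇒≤∑ f (here refl) = m≤m+n _ _
  ∈⇒≤∑ f (there x∈)  = ≤-trans (∈⇒≤∑ f x∈) (m≤n+m _ _)

  -- Averaging: the step of the probabilistic method that turns a comparison of expectations into an
  -- outcome.
  ∑-<⇒∃< : ∀ (xs : List A) f g → ∑ xs f < ∑ xs g → ∃ λ x → f x < g x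
  ∑-<⇒∃< (x ∷ xs) f g lt with f x <? g x
  ... | yes fx<gx = x , fx<gx
  ... | no  fx≮gx = ∑-<⇒∃< xs f g
    (+-cancelˡ-< (g x) _ _ (≤-<-trans (+-monoˡ-≤ (∑ xs f) (≮⇒≥ fx≮gx)) lt))

∑-swap : ∀ {A B : Set} (xs : List A) (ys : List B) (f : A → B → ℕ) →
         ∑ xs (λ x → ∑ ys (f x)) ≡ ∑ ys (λ y → ∑ xs (λ x → f x y))
∑-swap []       ys f = sym (trans (∑-const ys 0) (*-zeroʳ (length ys)))
∑-swap (x ∷ xs) ys f =
  trans (cong (∑ ys (f x) +_) (∑-swap xs ys f))
        (sym (∑-+ ys (f x) (λ y → ∑ xs (λ x → f x y))))

∑-cartesianProductWith : ∀ {A B C : Set} (_∙_ : A → B → C) (h : C → ℕ) xs ys →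
  ∑ (cartesianProductWith _∙_ xs ys) h ≡ ∑ xs (λ x → ∑ ys (λ y → h (x ∙ y)))
∑-cartesianProductWith _∙_ h []       ys = refl
∑-cartesianProductWith _∙_ h (x ∷ xs) ys = begin
  ∑ (List.map (x ∙_) ys List.++ zs) h
    ≡⟨ cong sum (map-++ h (List.map (x ∙_) ys) zs) ⟩
  sum (List.map h (List.map (x ∙_) ys) List.++ List.map h zs)
    ≡⟨ sum-++ (List.map h (List.map (x ∙_) ys)) _ ⟩
  sum (List.map h (List.map (x ∙_) ys)) + ∑ zs h
    ≡⟨ cong₂ _+_ (cong sum (sym (map-∘ ys))) (∑-cartesianProductWith _∙_ h xs ys) ⟩
  ∑ ys (λ y → h (x ∙ y)) + ∑ xs (λ x → ∑ ys (λ y → h (x ∙ y))) ∎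
  where
  open ≡-Reasoning
  zs = cartesianProductWith _∙_ xs ys

length-cartesianProductWith : ∀ {A B C : Set} (f : A → B → C) xs ys →
  length (cartesianProductWith f xs ys) ≡ length xs * length ys
length-cartesianProductWith f []       ys = refl
length-cartesianProductWith f (x ∷ xs) ys =
  trans (length-++ (List.map (f x) ys))
        (cong₂ _+_ (length-map (f x) ys) (length-cartesianProductWith f xs ys))

length-vectors : ∀ {A : Set} (xs : List A) n → length (vectors xs n) ≡ length xs ^ n
length-vectors xs zero    = refl
length-vectors xs (suc n) =
  trans (length-cartesianProductWith _∷_ xs (vectors xs n))
        (cong (length xs *_) (length-vectors xs n))

∈-vectors : ∀ {A : Set} {xs : List A} → (∀ x → x ∈ xs) → ∀ {n} (v : Vec A n) → v ∈ vectors xs n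
∈-vectors all []      = here refl
∈-vectors all (x ∷ v) = ∈-cartesianProductWith⁺ _∷_ (all x) (∈-vectors all v)

-- Random tables, rectangles on which they are true, and the first moment method.

⟦_⟧ : Bool → ℕ
⟦ b ⟧ = if b then 1 else 0

⟦∧⟧ : ∀ a b → ⟦ a ∧ b ⟧ ≡ ⟦ a ⟧ * ⟦ b ⟧
⟦∧⟧ true  b = sym (+-identityʳ _)
⟦∧⟧ false b = refl

⟦⟧≤1 : ∀ b → ⟦ b ⟧ ≤ 1
⟦⟧≤1 true  = s≤s z≤n
⟦⟧≤1 false = z≤n

-- Boolean vectors serve both as sequences of random bits and, under the name `S`, as characteristic
-- vectors of sets of positions.
card : ∀ {n} → Vec Bool n → ℕ
card []          = 0
card (true  ∷ S) = suc (card S)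
card (false ∷ S) = card S

allOn : ∀ {n} → Vec Bool n → Vec Bool n → Bool
allOn []          []      = true
allOn (true  ∷ S) (v ∷ vs) = v ∧ allOn S vs
allOn (false ∷ S) (v ∷ vs) = allOn S vs

-- The probability that a random vector over xs satisfies g on S is the
-- |S|-th power of the probability of g, here with denominators cleared.
∑-allOn : ∀ {A : Set} (xs : List A) (g : A → Bool) {n} (S : Vec Bool n) →
          ∑ (vectors xs n) (λ v → ⟦ allOn S (Vec.map g v) ⟧) * length xs ^ card S
          ≡ ∑ xs (⟦_⟧ ∘ g) ^ card S * length xs ^ n
∑-allOn xs g []          = refl
∑-allOn xs g {suc n} (true ∷ S) = begin
  ∑ (vectors xs (suc n)) (λ v → ⟦ allOn (true ∷ S) (Vec.map g v) ⟧) * (L * L ^ c)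
    ≡⟨ cong (_* (L * L ^ c)) (∑-cartesianProductWith _∷_ _ xs (vectors xs n)) ⟩
  ∑ xs (λ x → ∑ V (λ v → ⟦ g x ∧ φ v ⟧)) * (L * L ^ c)
    ≡⟨ cong (_* (L * L ^ c))
         (∑-cong xs λ x → trans (∑-cong V λ v → ⟦∧⟧ (g x) (φ v)) (∑-*ˡ V ⟦ g x ⟧ _)) ⟩
  ∑ xs (λ x → ⟦ g x ⟧ * ∑ V (⟦_⟧ ∘ φ)) * (L * L ^ c)
    ≡⟨ cong (_* (L * L ^ c)) (∑-*ʳ xs _ (⟦_⟧ ∘ g)) ⟩
  ∑ xs (⟦_⟧ ∘ g) * ∑ V (⟦_⟧ ∘ φ) * (L * L ^ c)
    ≡⟨ lemma (∑ xs (⟦_⟧ ∘ g)) (∑ V (⟦_⟧ ∘ φ)) L (L ^ c) ⟩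
  ∑ xs (⟦_⟧ ∘ g) * L * (∑ V (⟦_⟧ ∘ φ) * L ^ c)
    ≡⟨ cong (∑ xs (⟦_⟧ ∘ g) * L *_) (∑-allOn xs g S) ⟩
  ∑ xs (⟦_⟧ ∘ g) * L * (∑ xs (⟦_⟧ ∘ g) ^ c * L ^ n)
    ≡⟨ [m*n]*[o*p]≡[m*o]*[n*p] (∑ xs (⟦_⟧ ∘ g)) L _ _ ⟩
  ∑ xs (⟦_⟧ ∘ g) * ∑ xs (⟦_⟧ ∘ g) ^ c * (L * L ^ n) ∎
  where
  open ≡-Reasoning
  L = length xs
  c = card S
  V = vectors xs n
  φ : Vec _ n → Bool
  φ v = allOn S (Vec.map g v)
  lemma : ∀ a b c d → a * b * (c * d) ≡ a * c * (b * d)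
  lemma = solve-∀
∑-allOn xs g {suc n} (false ∷ S) = begin
  ∑ (vectors xs (suc n)) (λ v → ⟦ allOn (false ∷ S) (Vec.map g v) ⟧) * L ^ c
    ≡⟨ cong (_* L ^ c) (∑-cartesianProductWith _∷_ _ xs (vectors xs n)) ⟩
  ∑ xs (λ x → E) * L ^ c
    ≡⟨ cong (_* L ^ c) (∑-const xs E) ⟩
  L * E * L ^ c
    ≡⟨ *-assoc L E _ ⟩
  L * (E * L ^ c)
    ≡⟨ cong (L *_) (∑-allOn xs g S) ⟩
  L * (∑ xs (⟦_⟧ ∘ g) ^ c * L ^ n)
    ≡⟨ lemma L (∑ xs (⟦_⟧ ∘ g) ^ c) (L ^ n) ⟩
  ∑ xs (⟦_⟧ ∘ g) ^ c * (L * L ^ n) ∎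
  where
  open ≡-Reasoning
  L = length xs
  c = card S
  E = ∑ (vectors xs n) (λ v → ⟦ allOn S (Vec.map g v) ⟧)
  lemma : ∀ a b c → a * (b * c) ≡ b * (a * c)
  lemma = solve-∀

Table : ℕ → Set
Table M = Vec (Vec Bool M) M

onRectangle : ∀ {M} → Table M → Vec Bool M → Vec Bool M → Bool
onRectangle b S S′ = allOn S (Vec.map (allOn S′) b)

-- Makes a table entry true with probability a / (a + 1).
coin : ℕ → List Bool
coin a = false ∷ List.replicate a true

-- A finite probability space: multiplicities in `coin` replace weights, so an expectation is a sum
-- over this list divided by its length, and the entries of a table are independent.
tables : ℕ → ∀ M → List (Table M)
tables a M = vectors (vectors (coin a) M) M

length-coin : ∀ a → length (coin a) ≡ suc a
length-coin zero    = refl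
length-coin (suc a) = cong suc (length-coin a)

∑-coin : ∀ a → ∑ (coin a) ⟦_⟧ ≡ a
∑-coin zero    = refl
∑-coin (suc a) = cong suc (∑-coin a)

length-tables : ∀ a M → length (tables a M) ≡ (suc a ^ M) ^ M
length-tables a M =
  trans (length-vectors _ M)
        (cong (_^ M) (trans (length-vectors (coin a) M) (cong (_^ M) (length-coin a))))

^-distrib-* : ∀ m n o → (m * n) ^ o ≡ m ^ o * n ^ o
^-distrib-* m n zero    = refl
^-distrib-* m n (suc o) = trans (cong (m * n *_) (^-distrib-* m n o)) ([m*n]*[o*p]≡[m*o]*[n*p] m n _ _)

*-swapʳ : ∀ a b c → a * b * c ≡ a * c * b
*-swapʳ = solve-∀

-- Two uses of `∑-allOn`: within a row, whose entries are independent coins, and then over the rows,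
-- which satisfy `allOn S′` independently. The second use brings in the factor `L ^ c`, which is
-- cancelled.
∑-onRectangle : ∀ a {M} (S S′ : Vec Bool M) {s s′} → card S ≡ s → card S′ ≡ s′ →
  ∑ (tables a M) (λ b → ⟦ onRectangle b S S′ ⟧) * suc a ^ (s′ * s)
  ≡ a ^ (s′ * s) * length (tables a M)
∑-onRectangle a {M} S S′ refl refl =
  *-cancelʳ-≡ _ _ (L ^ c) {{nz}} (begin
  E * suc a ^ (c′ * c) * L ^ c
    ≡⟨ cong (λ x → E * x * L ^ c) (sym (^-*-assoc (suc a) c′ c)) ⟩
  E * (suc a ^ c′) ^ c * L ^ c
    ≡⟨ *-swapʳ E _ (L ^ c) ⟩
  E * L ^ c * (suc a ^ c′) ^ c
    ≡⟨ cong (_* (suc a ^ c′) ^ c) (∑-allOn V (allOn S′) S) ⟩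
  e ^ c * L ^ M * (suc a ^ c′) ^ c
    ≡⟨ *-swapʳ (e ^ c) (L ^ M) _ ⟩
  e ^ c * (suc a ^ c′) ^ c * L ^ M
    ≡⟨ cong (_* L ^ M) (sym (^-distrib-* e _ c)) ⟩
  (e * suc a ^ c′) ^ c * L ^ M
    ≡⟨ cong (λ x → x ^ c * L ^ M) inner ⟩
  (a ^ c′ * L) ^ c * L ^ M
    ≡⟨ cong (_* L ^ M) (trans (^-distrib-* (a ^ c′) L c) (cong (_* L ^ c) (^-*-assoc a c′ c))) ⟩
  a ^ (c′ * c) * L ^ c * L ^ M
    ≡⟨ *-swapʳ (a ^ (c′ * c)) (L ^ c) (L ^ M) ⟩
  a ^ (c′ * c) * L ^ M * L ^ c
    ≡⟨ cong (λ x → a ^ (c′ * c) * x * L ^ c) (sym (length-vectors V M)) ⟩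
  a ^ (c′ * c) * length (tables a M) * L ^ c ∎)
  where
  open ≡-Reasoning
  V = vectors (coin a) M
  L = length V
  c = card S
  c′ = card S′
  E = ∑ (tables a M) (λ b → ⟦ onRectangle b S S′ ⟧)
  e = ∑ V (λ v → ⟦ allOn S′ v ⟧)
  L≡ : L ≡ suc a ^ M
  L≡ = trans (length-vectors (coin a) M) (cong (_^ M) (length-coin a))
  nz : NonZero (L ^ c)
  nz = m^n≢0 L c {{subst NonZero (sym L≡) (m^n≢0 (suc a) M)}}
  inner : e * suc a ^ c′ ≡ a ^ c′ * L
  inner = begin
    e * suc a ^ c′
      ≡⟨ cong₂ _*_ (∑-cong V λ v → cong (⟦_⟧ ∘ allOn S′) (sym (Vec.map-id v)))
                   (cong (_^ c′) (sym (length-coin a))) ⟩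
    ∑ V (λ v → ⟦ allOn S′ (Vec.map id v) ⟧) * length (coin a) ^ c′
      ≡⟨ ∑-allOn (coin a) id S′ ⟩
    ∑ (coin a) ⟦_⟧ ^ c′ * length (coin a) ^ M
      ≡⟨ cong₂ _*_ (cong (_^ c′) (∑-coin a)) (sym (length-vectors (coin a) M)) ⟩
    a ^ c′ * L ∎

rectangles : ∀ {M} → Table M → List (Vec Bool M) → ℕ
rectangles b 𝒮 = ∑ 𝒮 (λ S → ∑ 𝒮 (λ S′ → ⟦ onRectangle b S S′ ⟧))

-- Linearity of expectation: since all sets in `𝒮` have `s` elements, every pair contributes the
-- same amount.
∑-rectangles : ∀ a {M} (𝒮 : List (Vec Bool M)) s → All (λ S → card S ≡ s) 𝒮 →
  ∑ (tables a M) (λ b → rectangles b 𝒮) * suc a ^ (s * s)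
  ≡ length 𝒮 * (length 𝒮 * (a ^ (s * s) * length (tables a M)))
∑-rectangles a {M} 𝒮 s card≡s = begin
  ∑ Ω (λ b → rectangles b 𝒮) * m
    ≡⟨ cong (_* m) (∑-swap Ω 𝒮 _) ⟩
  ∑ 𝒮 (λ S → ∑ Ω (λ b → ∑ 𝒮 (λ S′ → ⟦ onRectangle b S S′ ⟧))) * m
    ≡⟨ ∑-*ʳ 𝒮 m _ ⟨
  ∑ 𝒮 (λ S → ∑ Ω (λ b → ∑ 𝒮 (λ S′ → ⟦ onRectangle b S S′ ⟧)) * m)
    ≡⟨ ∑-constant (All.map (λ {S} → row {S}) card≡s) ⟩
  length 𝒮 * (length 𝒮 * (a ^ (s * s) * length Ω)) ∎
  where
  open ≡-Reasoning
  Ω = tables a M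
  m = suc a ^ (s * s)
  row : ∀ {S} → card S ≡ s →
        ∑ Ω (λ b → ∑ 𝒮 (λ S′ → ⟦ onRectangle b S S′ ⟧)) * m
        ≡ length 𝒮 * (a ^ (s * s) * length Ω)
  row {S} eq = begin
    ∑ Ω (λ b → ∑ 𝒮 (λ S′ → ⟦ onRectangle b S S′ ⟧)) * m
      ≡⟨ cong (_* m) (∑-swap Ω 𝒮 _) ⟩
    ∑ 𝒮 (λ S′ → ∑ Ω (λ b → ⟦ onRectangle b S S′ ⟧)) * m
      ≡⟨ ∑-*ʳ 𝒮 m _ ⟨
    ∑ 𝒮 (λ S′ → ∑ Ω (λ b → ⟦ onRectangle b S S′ ⟧) * m)
      ≡⟨ ∑-constant (All.map (λ {S′} eq′ → ∑-onRectangle a S S′ eq eq′) card≡s) ⟩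
    length 𝒮 * (a ^ (s * s) * length Ω) ∎

rectangles≤ : ∀ {M} (b : Table M) 𝒮 → rectangles b 𝒮 ≤ length 𝒮 * length 𝒮
rectangles≤ b 𝒮 = begin
  rectangles b 𝒮               ≤⟨ ∑-mono 𝒮 (λ S → ∑-mono 𝒮 (λ S′ → ⟦⟧≤1 (onRectangle b S S′))) ⟩
  ∑ 𝒮 (λ _ → ∑ 𝒮 (λ _ → 1))    ≡⟨ ∑-const 𝒮 _ ⟩
  length 𝒮 * ∑ 𝒮 (λ _ → 1)     ≡⟨ cong (length 𝒮 *_) (trans (∑-const 𝒮 1) (*-identityʳ _)) ⟩
  length 𝒮 * length 𝒮          ∎
  where open ≤-Reasoning

⟦⟧≤0 : ∀ {b} → ⟦ b ⟧ ≤ 0 → b ≡ false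
⟦⟧≤0 {false} _ = refl

-- First moment method: on average the number of full rectangles over 𝒫
-- exceeds T plus |𝒫|² times the number of those over 𝒯. A table for which this
-- holds has none over 𝒯, since it has at most |𝒫|² over 𝒫.
∃-table : ∀ a {M} (𝒫 𝒯 : List (Vec Bool M)) p s {K U V T} .{{_ : NonZero K}} .{{_ : NonZero V}} →
  All (λ S → card S ≡ p) 𝒫 → All (λ S → card S ≡ s) 𝒯 →
  suc a ^ (p * p) ≤ K * a ^ (p * p) →
  U * a ^ (s * s) ≤ suc a ^ (s * s) →
  length 𝒯 * length 𝒯 ≤ V → V * (4 * K) ≤ U →
  0 < length 𝒫 → 2 * K * T ≤ length 𝒫 * length 𝒫 →
  ∃ λ (b : Table M) → T < rectangles b 𝒫 ×
    (∀ {S S′} → S ∈ 𝒯 → S′ ∈ 𝒯 → onRectangle b S S′ ≡ false)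
∃-table a {M} 𝒫 𝒯 p s {K} {U} {V} {T} card𝒫 card𝒯 hP hT h𝒯 hV 0<N hN =
  conclude (∑-<⇒∃< Ω (λ b → T + N * N * rectangles b 𝒯) (λ b → rectangles b 𝒫) avg)
  where
  open ≤-Reasoning
  Ω = tables a M
  N = length 𝒫
  W = length Ω
  O = ∑ Ω (λ b → rectangles b 𝒫)
  B = ∑ Ω (λ b → rectangles b 𝒯)
  nzW : NonZero W
  nzW = subst NonZero (sym (length-tables a M)) (m^n≢0 (suc a ^ M) M {{m^n≢0 (suc a) M}})
  nzp = m^n≢0 (suc a) (p * p)
  nzs = m^n≢0 (suc a) (s * s)
  e₁ : ∀ n w m → n * n * w * m ≡ n * (n * (m * w))
  e₁ = solve-∀
  e₂ : ∀ n w k x → n * (n * (k * x * w)) ≡ k * (n * (n * (x * w)))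
  e₂ = solve-∀
  O≥ : N * N * W ≤ K * O
  O≥ = *-cancelʳ-≤ _ _ (suc a ^ (p * p)) {{nzp}} (begin
    N * N * W * suc a ^ (p * p)            ≡⟨ e₁ N W (suc a ^ (p * p)) ⟩
    N * (N * (suc a ^ (p * p) * W))        ≤⟨ *-monoʳ-≤ N (*-monoʳ-≤ N (*-monoˡ-≤ W hP)) ⟩
    N * (N * (K * a ^ (p * p) * W))        ≡⟨ e₂ N W K (a ^ (p * p)) ⟩
    K * (N * (N * (a ^ (p * p) * W)))      ≡⟨ cong (K *_) (∑-rectangles a 𝒫 p card𝒫) ⟨
    K * (O * suc a ^ (p * p))              ≡⟨ *-assoc K O _ ⟨
    K * O * suc a ^ (p * p)                ∎)
  L = length 𝒯
  B≤ : U * B ≤ L * L * W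
  B≤ = *-cancelʳ-≤ _ _ (suc a ^ (s * s)) {{nzs}} (begin
    U * B * suc a ^ (s * s)                ≡⟨ *-assoc U B _ ⟩
    U * (B * suc a ^ (s * s))              ≡⟨ cong (U *_) (∑-rectangles a 𝒯 s card𝒯) ⟩
    U * (L * (L * (a ^ (s * s) * W)))      ≡⟨ e₂ L W U (a ^ (s * s)) ⟨
    L * (L * (U * a ^ (s * s) * W))        ≤⟨ *-monoʳ-≤ L (*-monoʳ-≤ L (*-monoˡ-≤ W hT)) ⟩
    L * (L * (suc a ^ (s * s) * W))        ≡⟨ e₁ L W (suc a ^ (s * s)) ⟨
    L * L * W * suc a ^ (s * s)            ∎)
  B≤W : 4 * K * B ≤ W
  B≤W = *-cancelˡ-≤ V (begin
    V * (4 * K * B)   ≡⟨ *-assoc V (4 * K) B ⟨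
    V * (4 * K) * B   ≤⟨ *-monoˡ-≤ B hV ⟩
    U * B             ≤⟨ B≤ ⟩
    L * L * W         ≤⟨ *-monoˡ-≤ W h𝒯 ⟩
    V * W             ∎)
  e₃ : ∀ k w t n b → 4 * k * (w * t + n * b) ≡ 2 * (2 * k * t * w) + n * (4 * k * b)
  e₃ = solve-∀
  e₄ : ∀ x w → 2 * (x * w) + x * w + x * w ≡ 4 * (x * w)
  e₄ = solve-∀
  -- Per table, the left side is at most N²/(2K) + N²/(4K) by `hN` and `B≤W`, and the right side at
  -- least N²/K by `O≥`. As N is positive, the remaining quarter makes the inequality strict.
  avg : ∑ Ω (λ b → T + N * N * rectangles b 𝒯) < O
  avg = *-cancelˡ-< (4 * K) _ _ (begin-strict
    4 * K * ∑ Ω (λ b → T + N * N * rectangles b 𝒯)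
      ≡⟨ cong (4 * K *_) (trans (∑-+ Ω _ _) (cong₂ _+_ (∑-const Ω T) (∑-*ˡ Ω (N * N) _))) ⟩
    4 * K * (W * T + N * N * B)
      ≡⟨ e₃ K W T (N * N) B ⟩
    2 * (2 * K * T * W) + N * N * (4 * K * B)
      ≤⟨ +-mono-≤ (*-monoʳ-≤ 2 (*-monoˡ-≤ W hN)) (*-monoʳ-≤ (N * N) B≤W) ⟩
    2 * (N * N * W) + N * N * W
      <⟨ m<m+n _ (*-mono-≤ (*-mono-≤ 0<N 0<N) (>-nonZero⁻¹ W {{nzW}})) ⟩
    2 * (N * N * W) + N * N * W + N * N * W
      ≡⟨ e₄ (N * N) W ⟩
    4 * (N * N * W)
      ≤⟨ *-monoʳ-≤ 4 O≥ ⟩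
    4 * (K * O)
      ≡⟨ *-assoc 4 K O ⟨
    4 * K * O ∎)
  conclude : ∃ (λ b → T + N * N * rectangles b 𝒯 < rectangles b 𝒫) →
             ∃ λ (b : Table M) → T < rectangles b 𝒫 ×
               (∀ {S S′} → S ∈ 𝒯 → S′ ∈ 𝒯 → onRectangle b S S′ ≡ false)
  conclude (b , lt) = b , m+n≤o⇒m≤o (suc T) lt , λ {S} S∈ S′∈ →
    ⟦⟧≤0 (≤-trans (≤-trans (∈⇒≤∑ (λ S′ → ⟦ onRectangle b S S′ ⟧) S′∈)
                           (∈⇒≤∑ (λ S → ∑ 𝒯 (λ S′ → ⟦ onRectangle b S S′ ⟧)) S∈))
                  none)
    where
    vanishes : ∀ R → T + N * N * R < rectangles b 𝒫 → R ≤ 0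
    vanishes zero    _  = z≤n
    vanishes (suc R) lt = contradiction (begin-strict
      N * N                     ≤⟨ m≤m*n (N * N) (suc R) ⟩
      N * N * suc R             ≤⟨ m≤n+m _ T ⟩
      T + N * N * suc R         <⟨ lt ⟩
      rectangles b 𝒫            ≤⟨ rectangles≤ b 𝒫 ⟩
      N * N                     ∎) (<-irrefl refl)
    none : rectangles b 𝒯 ≤ 0
    none = vanishes (rectangles b 𝒯) lt

-- Bernoulli inequalities for powers of 1 - 1/m.

-- This is (1 - 1/m)^j ≥ 1 - j/m for m = a + 1, multiplied by m^(j+1).
bernoulli : ∀ a j → suc a ^ suc j ≤ a ^ j * suc a + j * suc a ^ j
bernoulli a zero    = ≤-reflexive (trans (*-comm (suc a) 1) (sym (+-identityʳ _)))
bernoulli a (suc j) = begin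
  suc a * suc a ^ suc j
    ≤⟨ *-monoʳ-≤ (suc a) (bernoulli a j) ⟩
  suc a * (a ^ j * suc a + j * suc a ^ j)
    ≡⟨ e a (a ^ j) j (suc a ^ j) ⟩
  a * a ^ j * suc a + (suc a * a ^ j + j * (suc a * suc a ^ j))
    ≤⟨ +-monoʳ-≤ (a * a ^ j * suc a)
         (+-monoˡ-≤ (j * suc a ^ suc j) (*-monoʳ-≤ (suc a) (^-monoˡ-≤ j (n≤1+n a)))) ⟩
  a * a ^ j * suc a + suc j * suc a ^ suc j ∎
  where
  open ≤-Reasoning
  e : ∀ a x j y → suc a * (x * suc a + j * y) ≡ a * x * suc a + (suc a * x + j * (suc a * y))
  e = solve-∀

-- With m = 2 j the lower bound 1 - j/m of `bernoulli` equals 1/2.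
half≤[1-1/2j]^j : ∀ a j .{{_ : NonZero j}} → suc a ≡ 2 * j → suc a ^ j ≤ 2 * a ^ j
half≤[1-1/2j]^j a j eq = *-cancelˡ-≤ j (+-cancelʳ-≤ (j * suc a ^ j) _ _ (begin
  j * suc a ^ j + j * suc a ^ j   ≡⟨ e₁ j (suc a ^ j) ⟩
  2 * j * suc a ^ j               ≡⟨ cong (_* suc a ^ j) eq ⟨
  suc a ^ suc j                   ≤⟨ bernoulli a j ⟩
  a ^ j * suc a + j * suc a ^ j   ≡⟨ cong (_+ j * suc a ^ j) (trans (cong (a ^ j *_) eq) (e₂ j (a ^ j))) ⟩
  j * (2 * a ^ j) + j * suc a ^ j ∎))
  where
  open ≤-Reasoning
  e₁ : ∀ j x → j * x + j * x ≡ 2 * j * x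
  e₁ = solve-∀
  e₂ : ∀ j x → x * (2 * j) ≡ j * (2 * x)
  e₂ = solve-∀

-- The left side consists of the two leading terms in the binomial expansion of the right side.
bernoulli′ : ∀ a n → a ^ suc n + suc n * a ^ n ≤ suc a ^ suc n
bernoulli′ a zero    = ≤-reflexive (e a)
  where
  e : ∀ a → a * 1 + 1 ≡ suc a * 1
  e = solve-∀
bernoulli′ a (suc n) = begin
  a ^ suc (suc n) + suc (suc n) * a ^ suc n
    ≤⟨ m≤m+n _ (suc n * a ^ n) ⟩
  a ^ suc (suc n) + suc (suc n) * a ^ suc n + suc n * a ^ n
    ≡⟨ e a n (a ^ n) ⟩
  suc a * (a ^ suc n + suc n * a ^ n)
    ≤⟨ *-monoʳ-≤ (suc a) (bernoulli′ a n) ⟩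
  suc a ^ suc (suc n) ∎
  where
  open ≤-Reasoning
  e : ∀ a n x → a * (a * x) + suc (suc n) * (a * x) + suc n * x ≡ suc a * (a * x + suc n * x)
  e = solve-∀

-- In `bernoulli′` with n = a, the second term is already at least the first one.
[1-1/m]^m≤half : ∀ a → 2 * a ^ suc a ≤ suc a ^ suc a
[1-1/m]^m≤half a = begin
  2 * a ^ suc a               ≡⟨ cong (a ^ suc a +_) (+-identityʳ _) ⟩
  a ^ suc a + a * a ^ a       ≤⟨ +-monoʳ-≤ (a ^ suc a) (m≤n+m (a * a ^ a) (a ^ a)) ⟩
  a ^ suc a + suc a * a ^ a   ≤⟨ bernoulli′ a a ⟩
  suc a ^ suc a               ∎
  where open ≤-Reasoning

-- Binary trees and their codes.

data Tree : Set where
  leaf : Tree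
  node : Tree → Tree → Tree

size : Tree → ℕ
size leaf       = 0
size (node s t) = suc (size s + size t)

-- Preorder notation: n internal nodes take 2 n + 1 bits, which bounds the number of such trees by
-- 2^(2n+1).
encode : Tree → List Bool
encode leaf       = false ∷ []
encode (node s t) = true ∷ encode s List.++ encode t

-- One move of a stack machine that reads a word from its last letter on. The last clause is a
-- default for words that are not codes.
push : Bool → List Tree → List Tree
push false ts           = leaf ∷ ts
push true  (s ∷ t ∷ ts) = node s t ∷ ts
push true  ts           = ts

parse : List Bool → List Tree
parse = List.foldr push []

top : List Tree → Tree
top []      = leaf
top (t ∷ _) = t

decode : List Bool → Tree
decode = top ∘ parse

-- The trailing word `w` makes the induction work: when the code of the left subtree is read, the
-- right subtree is already on the stack.
parse-encode : ∀ t w → parse (encode t List.++ w) ≡ t ∷ parse w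
parse-encode leaf       w = refl
parse-encode (node s t) w
  rewrite ++-assoc (encode s) (encode t) w
        | parse-encode s (encode t List.++ w)
        | parse-encode t w = refl

decode-encode : ∀ t → decode (encode t) ≡ t
decode-encode t = cong top (trans (cong parse (sym (++-identityʳ (encode t)))) (parse-encode t []))

length-encode : ∀ t → length (encode t) ≡ suc (2 * size t)
length-encode leaf       = refl
length-encode (node s t) = cong suc (trans (length-++ (encode s))
  (trans (cong₂ _+_ (length-encode s) (length-encode t)) (eq (size s) (size t))))
  where
  eq : ∀ m n → suc (2 * m) + suc (2 * n) ≡ 2 * suc (m + n)
  eq = solve-∀

-- Trees and leaves as sets of nodes of the complete binary tree.

-- The internal nodes of the complete binary tree with 2 ^ r leaves, root
-- first, then those of the left and the right half.

#nodes : ℕ → ℕ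
#nodes zero    = 0
#nodes (suc r) = suc (#nodes r + #nodes r)

nodes : ∀ r → Tree → Vec Bool (#nodes r)
nodes zero    _          = []
nodes (suc r) leaf       = Vec.replicate _ false
nodes (suc r) (node s t) = true ∷ nodes r s Vec.++ nodes r t

nodes-leaf : ∀ r → nodes r leaf ≡ Vec.replicate _ false
nodes-leaf zero    = refl
nodes-leaf (suc r) = refl

card-++ : ∀ {m n} (S : Vec Bool m) (T : Vec Bool n) → card (S Vec.++ T) ≡ card S + card T
card-++ []          T = refl
card-++ (true  ∷ S) T = cong suc (card-++ S T)
card-++ (false ∷ S) T = card-++ S T

card-replicate-false : ∀ n → card (Vec.replicate n false) ≡ 0
card-replicate-false zero    = refl
card-replicate-false (suc n) = card-replicate-false n

card-leaf : ∀ r → card (nodes r leaf) ≡ 0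
card-leaf r = trans (cong card (nodes-leaf r)) (card-replicate-false (#nodes r))

lookup-leaf : ∀ r z → lookup (nodes r leaf) z ≢ true
lookup-leaf r z eq
  with () ← trans (sym eq) (trans (cong (λ v → lookup v z) (nodes-leaf r)) (Vec.lookup-replicate z false))

wordNodes : ∀ r {m} → Vec Bool m → Vec Bool (#nodes r)
wordNodes r = nodes r ∘ decode ∘ Vec.toList

words : ∀ m → List (Vec Bool m)
words = vectors (true ∷ false ∷ [])

-- A word may decode to a tree of another size, and `nodes` cuts off a tree deeper than r. The
-- filter restores the common cardinality that the first moment computation needs.
subtrees : ∀ r → ℕ → List (Vec Bool (#nodes r))
subtrees r n = filter (λ S → card S ≟ n) (List.map (wordNodes r) (words (suc (2 * n))))

card-subtrees : ∀ r n → All (λ S → card S ≡ n) (subtrees r n)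
card-subtrees r n = all-filter (λ S → card S ≟ n) (List.map (wordNodes r) (words (suc (2 * n))))

length-subtrees : ∀ r n → length (subtrees r n) ≤ 2 ^ suc (2 * n)
length-subtrees r n = begin
  length (subtrees r n)                ≤⟨ length-filter (λ S → card S ≟ n) (List.map (wordNodes r) ws) ⟩
  length (List.map (wordNodes r) ws)   ≡⟨ length-map (wordNodes r) ws ⟩
  length ws                            ≡⟨ length-vectors _ (suc (2 * n)) ⟩
  2 ^ suc (2 * n)                      ∎
  where
  open ≤-Reasoning
  ws = words (suc (2 * n))

∈-subtrees : ∀ r {n} t → size t ≡ n → card (nodes r t) ≡ n → nodes r t ∈ subtrees r n
∈-subtrees r t refl eq = ∈-filter⁺ (λ S → card S ≟ size t) (member (length-encode t)) eq
  where
  bools : ∀ b → b ∈ true ∷ false ∷ []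
  bools true  = here refl
  bools false = there (here refl)
  member : ∀ {m} → length (encode t) ≡ m → nodes r t ∈ List.map (wordNodes r) (words m)
  member refl = subst (_∈ List.map (wordNodes r) (words _))
    (cong (nodes r) (trans (cong decode (Vec.toList∘fromList (encode t))) (decode-encode t)))
    (∈-map⁺ (wordNodes r) (∈-vectors bools (Vec.fromList (encode t))))

-- The leaves are numbered 0, …, 2 ^ r - 1; only x < 2 ^ r is meaningful.
path : ℕ → ℕ → Tree
path zero    x = leaf
path (suc r) x with x <? 2 ^ r
... | yes _ = node (path r x) leaf
... | no  _ = node leaf (path r (x ∸ 2 ^ r))

ancestors : ∀ r → ℕ → Vec Bool (#nodes r)
ancestors r x = nodes r (path r x)

card-ancestors : ∀ r x → card (ancestors r x) ≡ r
card-ancestors zero    x = refl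
card-ancestors (suc r) x with x <? 2 ^ r
... | yes _ = cong suc (trans (card-++ (nodes r (path r x)) _)
  (trans (cong₂ _+_ (card-ancestors r x) (card-leaf r)) (+-identityʳ r)))
... | no  _ = cong suc (trans (card-++ (nodes r leaf) _)
  (cong₂ _+_ (card-leaf r) (card-ancestors r (x ∸ 2 ^ r))))

ancestors-root : ∀ r x → lookup (ancestors (suc r) x) zero ≡ true
ancestors-root r x with x <? 2 ^ r
... | yes _ = refl
... | no  _ = refl

ancestors-left : ∀ r x z → x < 2 ^ r → lookup (ancestors r x) z ≡ true →
                 lookup (ancestors (suc r) x) (suc (z Fin.↑ˡ #nodes r)) ≡ true
ancestors-left r x z x< eq with x <? 2 ^ r
... | yes _  = trans (Vec.lookup-++ˡ (nodes r (path r x)) _ z) eq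
... | no  x≮ = contradiction x< x≮

ancestors-right : ∀ r x z → 2 ^ r ≤ x → lookup (ancestors r (x ∸ 2 ^ r)) z ≡ true →
                  lookup (ancestors (suc r) x) (suc (#nodes r Fin.↑ʳ z)) ≡ true
ancestors-right r x z ≤x eq with x <? 2 ^ r
... | yes x< = contradiction x< (≤⇒≯ ≤x)
... | no  _  = trans (Vec.lookup-++ʳ (nodes r leaf) _ z) eq

-- Spanning trees of disjoint intervals of leaves.

-- At most one of the disjoint intervals [u a , v a] straddles h. One interval
-- is dropped even if none does, so that a node and the spanning trees of its
-- two halves together have exactly as many nodes as there are intervals.
split-at : ∀ h n (u v : ℕ → ℕ) → (∀ {a b} → a < b → b < suc n → v a < u b) →
  ∃ λ j → j ≤ n × (∀ {a} → a < j → v a < h) × (∀ {a} → j < a → a < suc n → h ≤ u a)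
split-at h zero    u v v<u = 0 , z≤n , (λ ()) , λ 0<a a<1 → contradiction a<1 (≤⇒≯ 0<a)
split-at h (suc n) u v v<u with v 0 <? h
... | no  v0≮h = 0 , z≤n , (λ ()) , λ 0<a a<n → ≤-trans (≮⇒≥ v0≮h) (<⇒≤ (v<u 0<a a<n))
... | yes v0<h with split-at h n (u ∘ suc) (v ∘ suc) (λ a<b b<n → v<u (s≤s a<b) (s≤s b<n))
... | j , j≤n , below , above = suc j , s≤s j≤n , below′ , above′
  where
  below′ : ∀ {a} → a < suc j → v a < h
  below′ {zero}  _       = v0<h
  below′ {suc a} (s≤s p) = below p
  above′ : ∀ {a} → suc j < a → a < suc (suc n) → h ≤ u a
  above′ {suc a} (s≤s p) (s≤s q) = above p q

-- Each node has to lie above a whole interval, not only above its end points, so that a one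
-- anywhere in a block of an interval minor can be used. The size fixes the length of the code, and
-- the cardinality passes the filter in `subtrees`.
SpanningTree : ℕ → ℕ → (u v : ℕ → ℕ) → Set
SpanningTree r n u v = ∃ λ t → size t ≡ n × card (nodes r t) ≡ n ×
  (∀ z → lookup (nodes r t) z ≡ true →
   ∃ λ a → a < n × (∀ x → u a ≤ x → x ≤ v a → lookup (ancestors r x) z ≡ true))

-- The lowest common ancestors of the end points of n disjoint intervals are
-- n distinct nodes.
spanning-tree : ∀ r n (u v : ℕ → ℕ) →
  (∀ {a} → a < n → u a < v a) → (∀ {a b} → a < b → b < n → v a < u b) →
  (∀ {a} → a < n → v a < 2 ^ r) → SpanningTree r n u v
spanning-tree r       zero    u v u<v v<u v<2^r =
  leaf , refl , card-leaf r , λ z eq → contradiction eq (lookup-leaf r z)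
spanning-tree zero    (suc n) u v u<v v<u v<2^r =
  contradiction (≤-trans (s≤s (u<v z<s)) (v<2^r z<s)) λ { (s≤s ()) }
spanning-tree (suc r) (suc n) u v u<v v<u v<2^r
  with j , j≤n , below , above ← split-at (2 ^ r) n u v v<u =
  glue
    (spanning-tree r j u v
      (λ p → u<v (<-≤-trans p j≤1+n)) (λ p q → v<u p (<-≤-trans q j≤1+n)) below)
    (spanning-tree r (n ∸ j) u′ v′
      (λ p → ∸-monoˡ-< (u<v (bound p)) (above′ p))
      (λ p q → ∸-monoˡ-< (v<u (+-monoʳ-< (suc j) p) (bound q))
                 (≤-trans (above′ (<-trans p q)) (<⇒≤ (u<v (bound (<-trans p q))))))
      (λ {a} p → m<n+o⇒m∸n<o _ (2 ^ r) {{m^n≢0 2 r}}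
               (subst (v (suc j + a) <_) (cong (2 ^ r +_) (+-identityʳ (2 ^ r))) (v<2^r (bound p)))))
  where
  u′ v′ : ℕ → ℕ
  -- The dropped interval j is skipped, and the leaves of the right half are renumbered from 0.
  u′ a = u (suc j + a) ∸ 2 ^ r
  v′ a = v (suc j + a) ∸ 2 ^ r
  j≤1+n : j ≤ suc n
  j≤1+n = ≤-trans j≤n (n≤1+n n)
  bound : ∀ {a} → a < n ∸ j → suc j + a < suc n
  bound p = s≤s (subst (_ ≤_) (m+[n∸m]≡n j≤n) (+-monoʳ-< j p))
  above′ : ∀ {a} → a < n ∸ j → 2 ^ r ≤ u (suc j + a)
  above′ {a} p = above (s≤s (m≤m+n j a)) (bound p)
  glue : SpanningTree r j u v → SpanningTree r (n ∸ j) u′ v′ → SpanningTree (suc r) (suc n) u v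
  glue (s , size-s , card-s , cover-s) (t , size-t , card-t , cover-t) =
    node s t , cong suc (trans (cong₂ _+_ size-s size-t) (m+[n∸m]≡n j≤n)) ,
    cong suc (trans (card-++ (nodes r s) _) (trans (cong₂ _+_ card-s card-t) (m+[n∸m]≡n j≤n))) ,
    cover
    where
    cover : ∀ z → lookup (nodes (suc r) (node s t)) z ≡ true →
            ∃ λ a → a < suc n × (∀ x → u a ≤ x → x ≤ v a → lookup (ancestors (suc r) x) z ≡ true)
    -- The root lies above all leaves, in particular above interval 0.
    cover zero    _  = 0 , z<s , λ x _ _ → ancestors-root r x
    cover (suc z) eq with Fin.splitAt (#nodes r) z in split
    ... | inj₁ i with refl ← Fin.splitAt⁻¹-↑ˡ split
                  with a , a<j , below-a ← cover-s i (trans (sym (Vec.lookup-++ˡ (nodes r s) _ i)) eq) =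
      a , ≤-trans a<j j≤1+n , λ x u≤x x≤v →
        ancestors-left r x i (≤-<-trans x≤v (below a<j)) (below-a x u≤x x≤v)
    ... | inj₂ i with refl ← Fin.splitAt⁻¹-↑ʳ split
                  with a , a<n∸j , below-a ← cover-t i (trans (sym (Vec.lookup-++ʳ (nodes r s) _ i)) eq) =
      suc j + a , bound a<n∸j , λ x u≤x x≤v →
        ancestors-right r x i (≤-trans (above′ a<n∸j) u≤x)
          (below-a (x ∸ 2 ^ r) (∸-monoˡ-≤ (2 ^ r) u≤x) (∸-monoˡ-≤ (2 ^ r) x≤v))

-- From interval minors to rectangles in the table.

allOn⁺ : ∀ {n} (S v : Vec Bool n) → (∀ i → lookup S i ≡ true → lookup v i ≡ true) → allOn S v ≡ true
allOn⁺ []          []      h = refl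
allOn⁺ (true  ∷ S) (x ∷ v) h = cong₂ _∧_ (h zero refl) (allOn⁺ S v (h ∘ suc))
allOn⁺ (false ∷ S) (x ∷ v) h = allOn⁺ S v (h ∘ suc)

allOn⁻ : ∀ {n} (S v : Vec Bool n) → allOn S v ≡ true → ∀ i → lookup S i ≡ true → lookup v i ≡ true
allOn⁻ (true  ∷ S) (x ∷ v) h zero    _  = ∧-conicalˡ x _ h
allOn⁻ (true  ∷ S) (x ∷ v) h (suc i) eq = allOn⁻ S v (∧-conicalʳ x _ h) i eq
allOn⁻ (false ∷ S) (x ∷ v) h (suc i) eq = allOn⁻ S v h i eq

onRectangle⁺ : ∀ {M} (b : Table M) S S′ →
  (∀ i j → lookup S i ≡ true → lookup S′ j ≡ true → lookup (lookup b i) j ≡ true) →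
  onRectangle b S S′ ≡ true
onRectangle⁺ b S S′ h = allOn⁺ S _ λ i i∈S →
  trans (Vec.lookup-map i (allOn S′) b) (allOn⁺ S′ _ λ j j∈S′ → h i j i∈S j∈S′)

onRectangle⁻ : ∀ {M} (b : Table M) S S′ → onRectangle b S S′ ≡ true →
  ∀ i j → lookup S i ≡ true → lookup S′ j ≡ true → lookup (lookup b i) j ≡ true
onRectangle⁻ b S S′ h i j i∈S j∈S′ = allOn⁻ S′ _
  (trans (sym (Vec.lookup-map i (allOn S′) b)) (allOn⁻ S _ h i i∈S)) j j∈S′

IncreasingBelow : ℕ → (ℕ → ℕ) → Set
IncreasingBelow n x = ∀ {p q} → p < q → q < n → x p < x q

increasing⇒mono : ∀ {n x} → IncreasingBelow n x → ∀ {p q} → p ≤ q → q < n → x p ≤ x q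
increasing⇒mono {x = x} inc p≤q q<n with m≤n⇒m<n∨m≡n p≤q
... | inj₁ p<q  = <⇒≤ (inc p<q q<n)
... | inj₂ refl = ≤-refl

-- An ℓ × ℓ all-ones interval minor of A: x and y list ℓ consecutive groups of
-- ℓ rows and of ℓ columns, the a-th one starting at position ℓ * a.
record Grid (ℓ N : ℕ) (A : ℕ → ℕ → Bool) (x y : ℕ → ℕ) : Set where
  field
    x-increasing : IncreasingBelow (ℓ * ℓ) x
    y-increasing : IncreasingBelow (ℓ * ℓ) y
    x-bounded    : ∀ {p} → p < ℓ * ℓ → x p < N
    y-bounded    : ∀ {p} → p < ℓ * ℓ → y p < N
    one          : ∀ {a c} → a < ℓ → c < ℓ → A (x (ℓ * a + c)) (y (ℓ * c + a)) ≡ true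

module Groups (ℓ : ℕ) (1<ℓ : 1 < ℓ) where

  last : ℕ
  last = pred ℓ

  suc-last : suc last ≡ ℓ
  suc-last = suc-pred ℓ {{>-nonZero (<⇒≤ 1<ℓ)}}

  within : ∀ {a c} → a < ℓ → c < ℓ → ℓ * a + c < ℓ * ℓ
  within {a} {c} a<ℓ c<ℓ = begin-strict
    ℓ * a + c <⟨ +-monoʳ-< (ℓ * a) c<ℓ ⟩
    ℓ * a + ℓ ≡⟨ trans (+-comm (ℓ * a) ℓ) (sym (*-suc ℓ a)) ⟩
    ℓ * suc a ≤⟨ *-monoʳ-≤ ℓ a<ℓ ⟩
    ℓ * ℓ     ∎
    where open ≤-Reasoning

  last<ℓ : last < ℓ
  last<ℓ = ≤-reflexive suc-last

  -- The interval of a group runs from its first to its last element; these differ because 1 < ℓ.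
  group-tree : ∀ {r x} → IncreasingBelow (ℓ * ℓ) x → (∀ {p} → p < ℓ * ℓ → x p < 2 ^ r) →
               SpanningTree r ℓ (λ a → x (ℓ * a)) (λ a → x (ℓ * a + last))
  group-tree {r} {x} inc bounded = spanning-tree r ℓ _ _
    (λ {a} a<ℓ → inc (m<m+n (ℓ * a) (s≤s⁻¹ (subst (1 <_) (sym suc-last) 1<ℓ))) (within a<ℓ last<ℓ))
    (λ {a} {b} a<b b<ℓ → inc (before a<b) (subst (_< ℓ * ℓ) (+-identityʳ _) (within b<ℓ (<⇒≤ 1<ℓ))))
    (λ a<ℓ → bounded (within a<ℓ last<ℓ))
    where
    open ≤-Reasoning
    before : ∀ {a b} → a < b → ℓ * a + last < ℓ * b
    before {a} {b} a<b = begin-strict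
      ℓ * a + last <⟨ +-monoʳ-< (ℓ * a) last<ℓ ⟩
      ℓ * a + ℓ    ≡⟨ trans (+-comm (ℓ * a) ℓ) (sym (*-suc ℓ a)) ⟩
      ℓ * suc a    ≤⟨ *-monoʳ-≤ ℓ a<b ⟩
      ℓ * b        ∎

  ¬Grid : ∀ {r} (b : Table (#nodes r)) →
    (∀ {S S′} → S ∈ subtrees r ℓ → S′ ∈ subtrees r ℓ → onRectangle b S S′ ≡ false) →
    ∀ {x y} → ¬ Grid ℓ (2 ^ r) (λ i j → onRectangle b (ancestors r i) (ancestors r j)) x y
  ¬Grid {r} b none {x} {y} grid
    with s , size-s , card-s , cover-s ← group-tree {r} (Grid.x-increasing grid) (Grid.x-bounded grid)
       | t , size-t , card-t , cover-t ← group-tree {r} (Grid.y-increasing grid) (Grid.y-bounded grid)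
    = contradiction (trans (sym (onRectangle⁺ b (nodes r s) (nodes r t) full))
                           (none (∈-subtrees r s size-s card-s) (∈-subtrees r t size-t card-t)))
                    λ ()
    where
    between : ∀ {x} → IncreasingBelow (ℓ * ℓ) x → ∀ {a c} → a < ℓ → c < ℓ →
              x (ℓ * a) ≤ x (ℓ * a + c) × x (ℓ * a + c) ≤ x (ℓ * a + last)
    between inc {a} {c} a<ℓ c<ℓ =
      increasing⇒mono inc (m≤m+n (ℓ * a) c) (within a<ℓ c<ℓ) ,
      increasing⇒mono inc (+-monoʳ-≤ (ℓ * a) (s≤s⁻¹ (subst (c <_) (sym suc-last) c<ℓ))) (within a<ℓ last<ℓ)
    -- Node i lies above all of row group a and node j above all of column group c. So i and j are
    -- ancestors of the row and the column of the one in block (a , c), and this one forces `b` to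
    -- be true at (i , j).
    full : ∀ i j → lookup (nodes r s) i ≡ true → lookup (nodes r t) j ≡ true → lookup (lookup b i) j ≡ true
    full i j i∈s j∈t
      with a , a<ℓ , row ← cover-s i i∈s | c , c<ℓ , column ← cover-t j j∈t
      with lo , hi ← between (Grid.x-increasing grid) a<ℓ c<ℓ
         | lo′ , hi′ ← between (Grid.y-increasing grid) c<ℓ a<ℓ =
      onRectangle⁻ b (ancestors r (x (ℓ * a + c))) (ancestors r (y (ℓ * c + a)))
        (Grid.one grid a<ℓ c<ℓ) i j (row _ lo hi) (column _ lo′ hi′)

-- Parameters and existence of a matrix without the interval minor.

groups : ℕ → ℕ
groups t = 5 * (2 * (4 * (4 * t)))

-- The factors of groups t and side t balance three estimates for r = 4 t,
-- m = 32 t and ℓ = 160 t = 5 m: (1 - 1/m)^(r²) ≥ 2^(-t), (1 - 1/m)^(ℓ²) ≤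
-- 2^(-5ℓ), and there are at most 2^(4ℓ + 2) pairs of subtrees.
side : ℕ → ℕ
side t = 2 ^ (4 * t)

Σ< : ℕ → (ℕ → ℕ) → ℕ
Σ< n f = sum (applyUpTo f n)

ones₂ : ℕ → (ℕ → ℕ → Bool) → ℕ
ones₂ N A = Σ< N λ i → Σ< N λ j → ⟦ A i j ⟧

Σ<-cong : ∀ n {f g} → (∀ i → f i ≡ g i) → Σ< n f ≡ Σ< n g
Σ<-cong zero    eq = refl
Σ<-cong (suc n) eq = cong₂ _+_ (eq 0) (Σ<-cong n (eq ∘ suc))

-- The factor 2 pays for rounding n down to a multiple of N in `density`.
Gridless : (ℓ K N : ℕ) → Set
Gridless ℓ K N = ∃ λ A → 2 * K * N < ones₂ N A × (∀ {x y} → ¬ Grid ℓ N A x y)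

∃-gridless : ∀ t .{{_ : NonZero t}} → Gridless (groups t) (2 ^ t) (side t)
∃-gridless t {{t≢0}} =
  conclude (∃-table a 𝒫 (subtrees r ℓ) r ℓ {2 ^ t} {2 ^ (5 * ℓ)} {V} {2 * 2 ^ t * N}
              {{m^n≢0 2 t}} {{m*n≢0 _ _ {{m^n≢0 2 (suc (2 * ℓ))}} {{m^n≢0 2 (suc (2 * ℓ))}}}}
              (All-map⁺ (All.universal (card-ancestors r) (upTo N))) (card-subtrees r ℓ)
              sparse dense (*-mono-≤ (length-subtrees r ℓ) (length-subtrees r ℓ)) room
              (subst (0 <_) (sym length-𝒫) (m^n>0 2 r))
              (subst (2 * 2 ^ t * (2 * 2 ^ t * N) ≤_) (sym (cong₂ _*_ length-𝒫 length-𝒫)) total))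
  where
  open ≤-Reasoning
  r = 4 * t
  N = 2 ^ r
  -- A table entry is false with probability 1/(2j), so j entries are all true with probability at
  -- least 1/2. An entry of the matrix depends on r² = j t of them.
  j = 4 * (4 * t)
  ℓ = groups t
  a = pred (2 * j)
  𝒫 = List.map (ancestors r) (upTo N)
  V = 2 ^ suc (2 * ℓ) * 2 ^ suc (2 * ℓ)
  1≤t : 1 ≤ t
  1≤t = >-nonZero⁻¹ t
  j≢0 : NonZero j
  j≢0 = m*n≢0 4 (4 * t) {{_}} {{m*n≢0 4 t}}
  suc-a : suc a ≡ 2 * j
  suc-a = suc-pred (2 * j) {{m*n≢0 2 j {{_}} {{j≢0}}}}
  length-𝒫 : length 𝒫 ≡ N
  length-𝒫 = trans (length-map (ancestors r) (upTo N)) (length-upTo N)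
  r*r : ∀ t → 4 * t * (4 * t) ≡ 4 * (4 * t) * t
  r*r = solve-∀
  sparse : suc a ^ (r * r) ≤ 2 ^ t * a ^ (r * r)
  sparse = begin
    suc a ^ (r * r)       ≡⟨ trans (cong (suc a ^_) (r*r t)) (sym (^-*-assoc (suc a) j t)) ⟩
    (suc a ^ j) ^ t       ≤⟨ ^-monoˡ-≤ t (half≤[1-1/2j]^j a j {{j≢0}} suc-a) ⟩
    (2 * a ^ j) ^ t       ≡⟨ ^-distrib-* 2 (a ^ j) t ⟩
    2 ^ t * (a ^ j) ^ t   ≡⟨ cong (2 ^ t *_) (trans (^-*-assoc a j t) (cong (a ^_) (sym (r*r t)))) ⟩
    2 ^ t * a ^ (r * r)   ∎
  -- Since ℓ is 5 times m = `suc a`, the ℓ² factors 1 - 1/m form 5 ℓ packets of m, and the product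
  -- of each packet is at most 1/2.
  ℓ*ℓ : ℓ * ℓ ≡ suc a * (5 * ℓ)
  ℓ*ℓ = trans (cong (λ m → 5 * m * ℓ) (sym suc-a)) (eq (suc a) ℓ)
    where
    eq : ∀ m l → 5 * m * l ≡ m * (5 * l)
    eq = solve-∀
  dense : 2 ^ (5 * ℓ) * a ^ (ℓ * ℓ) ≤ suc a ^ (ℓ * ℓ)
  dense = begin
    2 ^ (5 * ℓ) * a ^ (ℓ * ℓ)
      ≡⟨ cong (2 ^ (5 * ℓ) *_) (trans (cong (a ^_) ℓ*ℓ) (sym (^-*-assoc a (suc a) (5 * ℓ)))) ⟩
    2 ^ (5 * ℓ) * (a ^ suc a) ^ (5 * ℓ)
      ≡⟨ ^-distrib-* 2 (a ^ suc a) (5 * ℓ) ⟨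
    (2 * a ^ suc a) ^ (5 * ℓ)
      ≤⟨ ^-monoˡ-≤ (5 * ℓ) ([1-1/m]^m≤half a) ⟩
    (suc a ^ suc a) ^ (5 * ℓ)
      ≡⟨ trans (^-*-assoc (suc a) (suc a) (5 * ℓ)) (cong (suc a ^_) (sym ℓ*ℓ)) ⟩
    suc a ^ (ℓ * ℓ) ∎
  t+4≤ℓ : 4 + t ≤ ℓ
  t+4≤ℓ = begin
    4 + t            ≤⟨ +-monoˡ-≤ t (*-monoʳ-≤ 4 1≤t) ⟩
    4 * t + t        ≡⟨ eq t ⟩
    5 * (1 * (1 * (1 * t)))
      ≤⟨ *-monoʳ-≤ 5 (*-mono-≤ {1} {2} (s≤s z≤n)
           (*-mono-≤ {1} {4} (s≤s z≤n) (*-monoˡ-≤ t {1} {4} (s≤s z≤n)))) ⟩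
    ℓ                ∎
    where
    eq : ∀ t → 4 * t + t ≡ 5 * (1 * (1 * (1 * t)))
    eq = solve-∀
  -- The pairs of subtrees use up 4 ℓ + 2 in the exponent; the fifth ℓ leaves room for the rest.
  room : V * (4 * 2 ^ t) ≤ 2 ^ (5 * ℓ)
  room = begin
    V * (4 * 2 ^ t)
      ≡⟨ cong₂ _*_ (^-distribˡ-+-* 2 (suc (2 * ℓ)) (suc (2 * ℓ))) (^-distribˡ-+-* 2 2 t) ⟨
    2 ^ (suc (2 * ℓ) + suc (2 * ℓ)) * 2 ^ (2 + t)
      ≡⟨ ^-distribˡ-+-* 2 (suc (2 * ℓ) + suc (2 * ℓ)) (2 + t) ⟨
    2 ^ (suc (2 * ℓ) + suc (2 * ℓ) + (2 + t))
      ≤⟨ ^-monoʳ-≤ 2 (begin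
        suc (2 * ℓ) + suc (2 * ℓ) + (2 + t) ≡⟨ eq ℓ t ⟩
        4 * ℓ + (4 + t)                     ≤⟨ +-monoʳ-≤ (4 * ℓ) t+4≤ℓ ⟩
        4 * ℓ + ℓ                           ≡⟨ +-comm (4 * ℓ) ℓ ⟩
        5 * ℓ                               ∎) ⟩
    2 ^ (5 * ℓ) ∎
    where
    eq : ∀ l t → suc (2 * l) + suc (2 * l) + (2 + t) ≡ 4 * l + (4 + t)
    eq = solve-∀
  -- Here N = 2^(4t) has to be at least the square of 2^(t+1), which holds because t ≥ 1.
  total : 2 * 2 ^ t * (2 * 2 ^ t * N) ≤ N * N
  total = begin
    2 * 2 ^ t * (2 * 2 ^ t * N)    ≡⟨ *-assoc (2 * 2 ^ t) (2 * 2 ^ t) N ⟨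
    2 ^ suc t * 2 ^ suc t * N      ≡⟨ cong (_* N) (^-distribˡ-+-* 2 (suc t) (suc t)) ⟨
    2 ^ (suc t + suc t) * N        ≤⟨ *-monoˡ-≤ N (^-monoʳ-≤ 2 (begin
        suc t + suc t              ≤⟨ +-mono-≤ (+-monoˡ-≤ t 1≤t) (+-monoˡ-≤ t 1≤t) ⟩
        t + t + (t + t)            ≡⟨ eq t ⟩
        4 * t                      ∎)) ⟩
    N * N                          ∎
    where
    eq : ∀ t → t + t + (t + t) ≡ 4 * t
    eq = solve-∀
  ∑-upTo : ∀ {A : Set} (g : ℕ → A) (f : A → ℕ) n → ∑ (List.map g (upTo n)) f ≡ Σ< n (f ∘ g)
  ∑-upTo g f n = cong sum (trans (sym (map-∘ (upTo n))) (map-upTo (f ∘ g) n))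
  conclude : ∃ (λ b → 2 * 2 ^ t * N < rectangles b 𝒫 ×
                 (∀ {S S′} → S ∈ subtrees r ℓ → S′ ∈ subtrees r ℓ → onRectangle b S S′ ≡ false)) →
             Gridless ℓ (2 ^ t) N
  conclude (b , many , none) =
    (λ i j → onRectangle b (ancestors r i) (ancestors r j)) ,
    subst (2 * 2 ^ t * N <_)
      (trans (∑-upTo (ancestors r) _ N)
             (Σ<-cong N (λ i → ∑-upTo (ancestors r) (λ S′ → ⟦ onRectangle b (ancestors r i) S′ ⟧) N)))
      many ,
    Groups.¬Grid ℓ (≤-trans (s≤s (s≤s z≤n)) (≤-trans (m≤m+n 4 t) t+4≤ℓ)) b none

-- Cylinders and graphs of involutions in higher dimension.

tabulateMatrix : ∀ {d n} → (Index d n → Bool) → Matrix d n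
tabulateMatrix {zero}  g = g []
tabulateMatrix {suc d} g = Vec.tabulate λ i → tabulateMatrix (g ∘ (i ∷_))

entry-tabulate : ∀ {d n} (g : Index d n → Bool) i → entry {d} (tabulateMatrix g) i ≡ g i
entry-tabulate g []      = refl
entry-tabulate g (x ∷ i) =
  trans (cong (λ A → entry A i) (Vec.lookup∘tabulate (λ x → tabulateMatrix (g ∘ (x ∷_))) x))
        (entry-tabulate (g ∘ (x ∷_)) i)

entry-submatrix : ∀ {d n k} (A : Matrix d n) (σs : Vec (Vec (Fin n) k) d) i →
                  entry (submatrix A σs) i ≡ entry A (Vec.zipWith lookup σs i)
entry-submatrix A []       []      = refl
entry-submatrix A (σ ∷ σs) (x ∷ i) =
  trans (cong (λ B → entry B i) (Vec.lookup-map x (λ y → submatrix (lookup A y) σs) σ))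
        (entry-submatrix (lookup A (lookup σ x)) σs i)

inCylinder : ∀ e {n} → (ℕ → ℕ → Bool) → Index (2 + e) n → Bool
inCylinder e g (x ∷ y ∷ _) = g (toℕ x) (toℕ y)

cylinder : ∀ e {n} → (ℕ → ℕ → Bool) → Matrix (2 + e) n
cylinder e g = tabulateMatrix (inCylinder e g)

module Graph {k : ℕ} (π : Fin k → Fin k) (π-involutive : ∀ x → π (π x) ≡ x) (e : ℕ) where

  point : Fin k → Index (2 + e) k
  point x = x ∷ π x ∷ Vec.replicate e x

  isPoint : Index (2 + e) k → Bool
  isPoint i = isYes (Vec.≡-dec Fin._≟_ i (point (Vec.head i)))

  graph : Matrix (2 + e) k
  graph = tabulateMatrix isPoint

  entry-point : ∀ x → entry graph (point x) ≡ true
  entry-point x = trans (entry-tabulate isPoint (point x)) go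
    where
    go : isPoint (point x) ≡ true
    go with Vec.≡-dec Fin._≟_ (point x) (point x)
    ... | yes _ = refl
    ... | no ¬p = contradiction refl ¬p

  entry⇒point : ∀ i → entry graph i ≡ true → i ≡ point (Vec.head i)
  entry⇒point i eq with Vec.≡-dec Fin._≟_ i (point (Vec.head i)) | trans (sym (entry-tabulate isPoint i)) eq
  ... | yes p | _  = p
  ... | no  _ | ()

  -- Every coordinate of `point` is the identity or π, hence its own inverse. This yields both the
  -- point in a given cross section and its uniqueness.
  coordinate-involutive : ∀ l x → lookup (point (lookup (point x) l)) l ≡ x
  coordinate-involutive zero          x = refl
  coordinate-involutive (suc zero)    x = π-involutive x
  coordinate-involutive (suc (suc l)) x = trans (Vec.lookup-replicate l _) (Vec.lookup-replicate l x)

  isPermutation : IsPermutation graph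
  isPermutation l v =
    point x , (coordinate-involutive l v , entry-point x) , λ {i} (i≡v , one) →
      sym (trans (entry⇒point i one) (cong point (head≡ i i≡v (entry⇒point i one))))
    where
    x = lookup (point v) l
    head≡ : ∀ i → lookup i l ≡ v → i ≡ point (Vec.head i) → Vec.head i ≡ x
    head≡ i i≡v i≡point = begin
      Vec.head i                                         ≡⟨ coordinate-involutive l (Vec.head i) ⟨
      lookup (point (lookup (point (Vec.head i)) l)) l   ≡⟨ cong (λ j → lookup (point (lookup j l)) l) i≡point ⟨
      lookup (point (lookup i l)) l                      ≡⟨ cong (λ y → lookup (point y) l) i≡v ⟩
      x                                                  ∎
      where open ≡-Reasoning

  -- An entry of the cylinder depends on its first two coordinates alone, so what remains is a
  -- containment of the matrix of π in dimension two.
  contains-cylinder : ∀ {n} (g : ℕ → ℕ → Bool) → Contains (cylinder e {n} g) graph →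
    ∃ λ (σ : Vec (Fin n) k) → ∃ λ (τ : Vec (Fin n) k) → Increasing σ × Increasing τ ×
      (∀ x → g (toℕ (lookup σ x)) (toℕ (lookup τ (π x))) ≡ true)
  contains-cylinder g (σ ∷ τ ∷ σs , σ↑ ∷ τ↑ ∷ _ , graph⊑) = σ , τ , σ↑ , τ↑ , λ x →
    trans (sym (trans (entry-submatrix (cylinder e g) (σ ∷ τ ∷ σs) (point x))
                      (entry-tabulate (inCylinder e g) (Vec.zipWith lookup (σ ∷ τ ∷ σs) (point x)))))
          (true≤ (subst (Bool._≤ entry (submatrix (cylinder e g) (σ ∷ τ ∷ σs)) (point x))
                        (entry-point x) (graph⊑ (point x))))
    where
    true≤ : ∀ {b} → true Bool.≤ b → b ≡ true
    true≤ Bool.b≤b = refl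

-- Counting ones by sums over initial segments.

sum-map-tabulate : ∀ n {A : Set} (F : Fin n → A) (h : A → ℕ) (φ : ℕ → ℕ) →
  (∀ i → h (F i) ≡ φ (toℕ i)) → Vec.sum (Vec.map h (Vec.tabulate F)) ≡ Σ< n φ
sum-map-tabulate zero    F h φ eq = refl
sum-map-tabulate (suc n) F h φ eq =
  cong₂ _+_ (eq zero) (sum-map-tabulate n (F ∘ suc) h (φ ∘ suc) (eq ∘ suc))

Σ<-const : ∀ n c → Σ< n (λ _ → c) ≡ n * c
Σ<-const zero    c = refl
Σ<-const (suc n) c = cong (c +_) (Σ<-const n c)

Σ<-*ʳ : ∀ n f c → Σ< n (λ i → f i * c) ≡ Σ< n f * c
Σ<-*ʳ zero    f c = refl
Σ<-*ʳ (suc n) f c = trans (cong (f 0 * c +_) (Σ<-*ʳ n (f ∘ suc) c)) (sym (*-distribʳ-+ c (f 0) _))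

ones-constant : ∀ d {n} b → ones {n} d (tabulateMatrix {d} (λ _ → b)) ≡ ⟦ b ⟧ * n ^ d
ones-constant zero        b = sym (*-identityʳ _)
ones-constant (suc d) {n} b = begin
  ones {n} (suc d) (tabulateMatrix {suc d} (λ _ → b))
    ≡⟨ sum-map-tabulate n (λ _ → tabulateMatrix {d} (λ _ → b)) (ones d) _ (λ _ → ones-constant d b) ⟩
  Σ< n (λ _ → ⟦ b ⟧ * n ^ d)
    ≡⟨ Σ<-const n _ ⟩
  n * (⟦ b ⟧ * n ^ d)
    ≡⟨ eq n ⟦ b ⟧ (n ^ d) ⟩
  ⟦ b ⟧ * (n * n ^ d) ∎
  where
  open ≡-Reasoning
  eq : ∀ n b x → n * (b * x) ≡ b * (n * x)
  eq = solve-∀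

ones-cylinder : ∀ e {n} (g : ℕ → ℕ → Bool) →
  ones {n} (2 + e) (cylinder e g) ≡ ones₂ n g * n ^ e
ones-cylinder e {n} g =
  trans (sum-map-tabulate n (λ x → tabulateMatrix {1 + e} (inCylinder e g ∘ (x ∷_))) (ones (1 + e)) _
         λ x →
         sum-map-tabulate n (λ y → tabulateMatrix {e} (inCylinder e g ∘ (x ∷_) ∘ (y ∷_))) (ones e) _ λ y →
         ones-constant e (g (toℕ x) (toℕ y)))
        (trans (Σ<-cong n λ x → Σ<-*ʳ n (λ y → ⟦ g x y ⟧) (n ^ e))
               (Σ<-*ʳ n (λ x → Σ< n λ y → ⟦ g x y ⟧) (n ^ e)))

Σ<-+ : ∀ m n f → Σ< (m + n) f ≡ Σ< m f + Σ< n (f ∘ (m +_))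
Σ<-+ zero    n f = refl
Σ<-+ (suc m) n f = trans (cong (f 0 +_) (Σ<-+ m n (f ∘ suc))) (sym (+-assoc (f 0) _ _))

Σ<-mono : ∀ n {f g} → (∀ i → i < n → f i ≤ g i) → Σ< n f ≤ Σ< n g
Σ<-mono zero    le = z≤n
Σ<-mono (suc n) le = +-mono-≤ (le 0 z<s) (Σ<-mono n λ i i<n → le (suc i) (s≤s i<n))

Σ<-extend : ∀ {m n} → m ≤ n → ∀ f → Σ< m f ≤ Σ< n f
Σ<-extend {m} m≤n f with o , refl ← m≤n⇒∃[o]m+o≡n m≤n =
  ≤-trans (m≤m+n _ _) (≤-reflexive (sym (Σ<-+ m o f)))

Σ<-block≤ : ∀ N s b f → b < s → Σ< N (λ i → f (b * N + i)) ≤ Σ< (s * N) f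
Σ<-block≤ N (suc s) zero    f _ = Σ<-extend (m≤m+n N (s * N)) f
Σ<-block≤ N (suc s) (suc b) f (s≤s b<s) = begin
  Σ< N (λ i → f (N + b * N + i))       ≡⟨ Σ<-cong N (λ i → cong f (+-assoc N (b * N) i)) ⟩
  Σ< N (λ i → f (N + (b * N + i)))     ≤⟨ Σ<-block≤ N s b (f ∘ (N +_)) b<s ⟩
  Σ< (s * N) (f ∘ (N +_))              ≤⟨ m≤n+m _ (Σ< N f) ⟩
  Σ< N f + Σ< (s * N) (f ∘ (N +_))     ≡⟨ Σ<-+ N (s * N) f ⟨
  Σ< (N + s * N) f                     ∎
  where open ≤-Reasoning

≤Σ<-blocks : ∀ N s c f → (∀ b → b < s → c ≤ Σ< N (λ i → f (b * N + i))) → s * c ≤ Σ< (s * N) f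
≤Σ<-blocks N zero    c f le = z≤n
≤Σ<-blocks N (suc s) c f le = begin
  c + s * c                            ≤⟨ +-mono-≤ (le 0 z<s) (≤Σ<-blocks N s c (f ∘ (N +_)) shifted) ⟩
  Σ< N f + Σ< (s * N) (f ∘ (N +_))     ≡⟨ Σ<-+ N (s * N) f ⟨
  Σ< (N + s * N) f                     ∎
  where
  open ≤-Reasoning
  shifted : ∀ b → b < s → c ≤ Σ< N (λ i → f (N + (b * N + i)))
  shifted b b<s = ≤-trans (le (suc b) (s≤s b<s))
    (≤-reflexive (Σ<-cong N λ i → cong f (+-assoc N (b * N) i)))

-- Antidiagonal block matrices.

-- Copies of the N × N matrix A in the blocks of an antidiagonal.
antidiagonal : (N : ℕ) .{{_ : NonZero N}} → ℕ → (ℕ → ℕ → Bool) → ℕ → ℕ → Bool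
antidiagonal N w A x y = (x / N + y / N ≡ᵇ w) ∧ A (x % N) (y % N)

≡ᵇ-refl : ∀ n → (n ≡ᵇ n) ≡ true
≡ᵇ-refl zero    = refl
≡ᵇ-refl (suc n) = ≡ᵇ-refl n

module _ (N : ℕ) .{{_ : NonZero N}} where

  [bN+i]/N : ∀ b {i} → i < N → (b * N + i) / N ≡ b
  [bN+i]/N b {i} i<N = begin
    (b * N + i) / N     ≡⟨ +-distrib-/-∣ˡ i (n∣m*n b) ⟩
    b * N / N + i / N   ≡⟨ cong₂ _+_ (m*n/n≡m b N) (m<n⇒m/n≡0 i<N) ⟩
    b + 0               ≡⟨ +-identityʳ b ⟩
    b                   ∎
    where
    open ≡-Reasoning

  [bN+i]%N : ∀ b {i} → i < N → (b * N + i) % N ≡ i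
  [bN+i]%N b {i} i<N = begin
    (b * N + i) % N ≡⟨ cong (_% N) (+-comm (b * N) i) ⟩
    (i + b * N) % N ≡⟨ [m+kn]%n≡m%n i b N ⟩
    i % N           ≡⟨ m<n⇒m%n≡m i<N ⟩
    i               ∎
    where open ≡-Reasoning

  -- For each b ≤ w, row block b holds one copy of A, in column block w - b.
  ones-antidiagonal : ∀ w A {n} → suc w * N ≤ n → suc w * ones₂ N A ≤ ones₂ n (antidiagonal N w A)
  ones-antidiagonal w A {n} sN≤n = begin
    suc w * ones₂ N A
      ≤⟨ ≤Σ<-blocks N (suc w) (ones₂ N A) _ (λ b b<s → Σ<-mono N λ i i<N → row b b<s i i<N) ⟩
    Σ< (suc w * N) (λ x → Σ< n λ y → ⟦ antidiagonal N w A x y ⟧)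
      ≤⟨ Σ<-extend sN≤n _ ⟩
    ones₂ n (antidiagonal N w A) ∎
    where
    open ≤-Reasoning
    cell : ∀ b → b < suc w → ∀ i → i < N → ∀ j → j < N →
           A i j ≡ antidiagonal N w A (b * N + i) ((w ∸ b) * N + j)
    cell b b<s i i<N j j<N
      rewrite [bN+i]/N b i<N | [bN+i]%N b i<N | [bN+i]/N (w ∸ b) j<N | [bN+i]%N (w ∸ b) j<N
            | m+[n∸m]≡n (s≤s⁻¹ b<s) | ≡ᵇ-refl w = refl
    row : ∀ b → b < suc w → ∀ i → i < N →
          Σ< N (λ j → ⟦ A i j ⟧) ≤ Σ< n (λ y → ⟦ antidiagonal N w A (b * N + i) y ⟧)
    row b b<s i i<N = begin
      Σ< N (λ j → ⟦ A i j ⟧)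
        ≤⟨ Σ<-mono N (λ j j<N → ≤-reflexive (cong ⟦_⟧ (cell b b<s i i<N j j<N))) ⟩
      Σ< N (λ j → ⟦ antidiagonal N w A (b * N + i) ((w ∸ b) * N + j) ⟧)
        ≤⟨ Σ<-block≤ N (suc w) (w ∸ b) _ (s≤s (m∸n≤m w b)) ⟩
      Σ< (suc w * N) (λ y → ⟦ antidiagonal N w A (b * N + i) y ⟧)
        ≤⟨ Σ<-extend sN≤n _ ⟩
      Σ< n (λ y → ⟦ antidiagonal N w A (b * N + i) y ⟧) ∎

  %-mono-< : ∀ {x y} → x < y → x / N ≡ y / N → x % N < y % N
  %-mono-< {x} {y} x<y x/N≡y/N = +-cancelʳ-< (y / N * N) _ _
    (subst₂ _<_ (trans (m≡m%n+[m/n]*n x N) (cong (λ q → x % N + q * N) x/N≡y/N)) (m≡m%n+[m/n]*n y N) x<y)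

-- The transposition pattern and the grid that a copy of it yields.

module Transposition (ℓ e : ℕ) where

  -- Besides the corner and the ℓ² cells there are `e` fixed points at the end, which pad the
  -- pattern to any size above ℓ².
  k : ℕ
  k = suc (ℓ * ℓ + e)

  cell : Fin ℓ → Fin ℓ → Fin k
  cell a c = suc (combine a c ↑ˡ e)

  swapped : Fin (ℓ * ℓ) → Fin k
  swapped w = uncurry (flip cell) (remQuot ℓ w)

  swapped-combine : ∀ a c → swapped (combine a c) ≡ cell c a
  swapped-combine a c = cong (uncurry (flip cell)) (Fin.remQuot-combine {ℓ} a c)

  transpose : Fin k → Fin k
  transpose zero    = zero
  transpose (suc i) = [ swapped , (λ _ → suc i) ]′ (splitAt (ℓ * ℓ) i)

  transpose-cell : ∀ a c → transpose (cell a c) ≡ cell c a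
  transpose-cell a c
    rewrite Fin.splitAt-↑ˡ (ℓ * ℓ) (combine a c) e = swapped-combine a c

  transpose-involutive : ∀ x → transpose (transpose x) ≡ x
  transpose-involutive zero = refl
  transpose-involutive (suc i) with splitAt (ℓ * ℓ) i in split
  ... | inj₂ w rewrite split = refl
  ... | inj₁ w with refl ← Fin.splitAt⁻¹-↑ˡ {i = i} split
               with a , c , refl ← Fin.combine-surjective {ℓ} {ℓ} w
    = trans (cong transpose (swapped-combine a c)) (transpose-cell c a)

  toℕ-cell : ∀ a c → toℕ (cell a c) ≡ suc (ℓ * toℕ a + toℕ c)
  toℕ-cell a c = cong suc (trans (Fin.toℕ-↑ˡ (combine a c) e) (Fin.toℕ-combine a c))

  -- `Grid` speaks of sequences on ℕ. Its positions stay below k after the shift past the corner,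
  -- and the default 0 lies beyond them.
  at : (Fin k → ℕ) → ℕ → ℕ
  at F p with p <? k
  ... | yes p<k = F (fromℕ< p<k)
  ... | no  _   = 0

  at-< : ∀ F {p} (p<k : p < k) → at F p ≡ F (fromℕ< p<k)
  at-< F {p} p<k with p <? k
  ... | yes _   = refl
  ... | no  p≮k = contradiction p<k p≮k

  at-cell : ∀ F {a c} (a<ℓ : a < ℓ) (c<ℓ : c < ℓ) →
            at F (suc (ℓ * a + c)) ≡ F (cell (fromℕ< a<ℓ) (fromℕ< c<ℓ))
  at-cell F {a} {c} a<ℓ c<ℓ = begin
    at F (suc (ℓ * a + c)) ≡⟨ cong (at F) toℕ≡ ⟨
    at F (toℕ i)           ≡⟨ at-< F (Fin.toℕ<n i) ⟩
    F (fromℕ< (Fin.toℕ<n i)) ≡⟨ cong F (Fin.fromℕ<-toℕ i (Fin.toℕ<n i)) ⟩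
    F i                    ∎
    where
    open ≡-Reasoning
    i = cell (fromℕ< a<ℓ) (fromℕ< c<ℓ)
    toℕ≡ : toℕ i ≡ suc (ℓ * a + c)
    toℕ≡ = trans (toℕ-cell (fromℕ< a<ℓ) (fromℕ< c<ℓ))
      (cong₂ (λ a c → suc (ℓ * a + c)) (Fin.toℕ-fromℕ< a<ℓ) (Fin.toℕ-fromℕ< c<ℓ))

  module _ {n : ℕ} (N : ℕ) .{{_ : NonZero N}} (w : ℕ) (A : ℕ → ℕ → Bool)
           (σ τ : Vec (Fin n) k) (σ↑ : Increasing σ) (τ↑ : Increasing τ)
           (one : ∀ i → antidiagonal N w A (toℕ (lookup σ i)) (toℕ (lookup τ (transpose i))) ≡ true) where

    X Y : Fin k → ℕ
    X i = toℕ (lookup σ i)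
    Y i = toℕ (lookup τ i)

    block-sum : ∀ i → X i / N + Y (transpose i) / N ≡ w
    block-sum i = ≡ᵇ⇒≡ _ _ (Equivalence.from T-≡ (∧-conicalˡ _ _ (one i)))

    corner≤ : ∀ {υ : Vec (Fin n) k} → Increasing υ → ∀ i → toℕ (lookup υ zero) ≤ toℕ (lookup υ i)
    corner≤ υ↑ zero    = ≤-refl
    corner≤ υ↑ (suc i) = <⇒≤ (υ↑ zero (suc i) z<s)

    -- The one in the corner precedes all others, so they all lie in its block.
    X-block : ∀ i → X zero / N ≡ X i / N
    X-block i = ≤-antisym (/-monoˡ-≤ N (corner≤ {σ} σ↑ i))
      (+-cancelʳ-≤ (Y zero / N) _ _ (begin
        X i / N + Y zero / N
          ≤⟨ +-monoʳ-≤ (X i / N) (/-monoˡ-≤ N (corner≤ {τ} τ↑ (transpose i))) ⟩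
        X i / N + Y (transpose i) / N
          ≡⟨ trans (block-sum i) (sym (block-sum zero)) ⟩
        X zero / N + Y zero / N ∎))
      where open ≤-Reasoning

    -- The block sum w and the common row block determine the column block of every one. Column i
    -- contains the one of row `transpose i`, so all columns are covered.
    Y-block : ∀ i → Y zero / N ≡ Y i / N
    Y-block i = +-cancelˡ-≡ (X zero / N) _ _ (begin
      X zero / N + Y zero / N
        ≡⟨ trans (block-sum zero) (sym (block-sum i′)) ⟩
      X i′ / N + Y (transpose i′) / N
        ≡⟨ cong₂ (λ q j → q + Y j / N) (sym (X-block i′)) (transpose-involutive i) ⟩
      X zero / N + Y i / N ∎)
      where
      open ≡-Reasoning
      i′ = transpose i

    -- All selected indices lie in a single block, where residues modulo N keep their order. The
    -- argument `suc p` skips the corner.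
    residue-increasing : ∀ {υ : Vec (Fin n) k} → Increasing υ →
      (∀ i → toℕ (lookup υ zero) / N ≡ toℕ (lookup υ i) / N) →
      IncreasingBelow (ℓ * ℓ) (λ p → at (toℕ ∘ lookup υ) (suc p) % N)
    residue-increasing {υ} υ↑ block {p} {q} p<q q<ℓ² =
      subst₂ _<_ (cong (_% N) (sym (at-< _ p<k))) (cong (_% N) (sym (at-< _ q<k)))
        (%-mono-< N (υ↑ _ _ (subst₂ _<_ (sym (Fin.toℕ-fromℕ< p<k)) (sym (Fin.toℕ-fromℕ< q<k)) (s≤s p<q)))
                    (trans (sym (block _)) (block _)))
      where
      q<k : suc q < k
      q<k = s≤s (≤-trans q<ℓ² (m≤m+n (ℓ * ℓ) e))
      p<k : suc p < k
      p<k = <-trans (s≤s p<q) q<k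

    -- The one in row `cell a c` lies in column `cell c a`, so row group a and column group c meet
    -- in a one for all a and c.
    grid : Grid ℓ N A (λ p → at X (suc p) % N) (λ p → at Y (suc p) % N)
    grid = record
      { x-increasing = residue-increasing {σ} σ↑ X-block
      ; y-increasing = residue-increasing {τ} τ↑ Y-block
      ; x-bounded    = λ _ → m%n<n _ N
      ; y-bounded    = λ _ → m%n<n _ N
      ; one          = λ a<ℓ c<ℓ →
          trans (cong₂ (λ x y → A (x % N) (y % N))
                  (at-cell X a<ℓ c<ℓ)
                  (trans (at-cell Y c<ℓ a<ℓ) (cong Y (sym (transpose-cell _ _)))))
                (∧-conicalʳ _ _ (one _))
      }

-- The lower bound on `f`.

∈-matrices : ∀ d {n} (A : Matrix d n) → A ∈ matrices d n
∈-matrices zero    true  = here refl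
∈-matrices zero    false = there (here refl)
∈-matrices (suc d) A     = ∈-vectors (∈-matrices d) A

ones≤f : ∀ {d n k} (A : Matrix d n) (P : Matrix d k) → Avoids {d} A P → ones d A ≤ f {d} n P
ones≤f {d} {n} A P avoids = All.lookup (xs≤max 0 _)
  (∈-map⁺ (ones d) (∈-filter⁺ (λ A → ¬? (contains? {d} A P)) (∈-matrices d A) avoids))

-- The s copies with at least 2KN ones each give 2KsN ≥ Kn ones; `E` counts their repetitions in the
-- cylinder.
density : ∀ K N s E {n O O′} → n ≤ 2 * (s * N) → 2 * K * N ≤ O → s * O ≤ O′ → K * (n * E) ≤ O′ * E
density K N s E {n} {O} {O′} n≤ ≤O ≤O′ = begin
  K * (n * E)               ≡⟨ *-assoc K n E ⟨
  K * n * E                 ≤⟨ *-monoˡ-≤ E (*-monoʳ-≤ K n≤) ⟩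
  K * (2 * (s * N)) * E     ≡⟨ cong (_* E) (eq K s N) ⟩
  s * (2 * K * N) * E       ≤⟨ *-monoˡ-≤ E (≤-trans (*-monoʳ-≤ s ≤O) ≤O′) ⟩
  O′ * E                    ∎
  where
  open ≤-Reasoning
  eq : ∀ x s n → x * (2 * (s * n)) ≡ s * (2 * x * n)
  eq = solve-∀

module _ (ℓ o e : ℕ) where

  open Transposition ℓ o using (k; transpose; transpose-involutive; grid)
  open Graph transpose transpose-involutive e using (graph; contains-cylinder)

  f-graph≥ : ∀ K N .{{_ : NonZero N}} → Gridless ℓ K N →
             ∀ n → N ≤ n → K * n ^ suc e ≤ f {2 + e} n graph
  f-graph≥ K N (A , many , gridless) n N≤n =
    ≤-trans (density K N (suc w) (n ^ e) n≤2sN (<⇒≤ many) (ones-antidiagonal N w A sN≤n))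
      (≤-trans (≤-reflexive (sym (ones-cylinder e {n} (antidiagonal N w A))))
               (ones≤f {2 + e} {n} {k} (cylinder e (antidiagonal N w A)) graph avoids))
    where
    open ≤-Reasoning
    -- The antidiagonal then has `suc w` = n / N blocks, as many as fit.
    w = pred (n / N)
    suc-w : suc w ≡ n / N
    suc-w = suc-pred (n / N) {{>-nonZero (m≥n⇒m/n>0 N≤n)}}
    sN≤n : suc w * N ≤ n
    sN≤n = subst (λ s → s * N ≤ n) (sym suc-w) (m/n*n≤m n N)
    n≤2sN : n ≤ 2 * (suc w * N)
    n≤2sN = begin
      n                      ≡⟨ m≡m%n+[m/n]*n n N ⟩
      n % N + n / N * N      ≡⟨ cong (λ s → n % N + s * N) suc-w ⟨
      n % N + suc w * N      ≤⟨ +-monoˡ-≤ (suc w * N) (≤-trans (<⇒≤ (m%n<n n N)) (m≤m+n N (w * N))) ⟩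
      suc w * N + suc w * N  ≡⟨ cong (_+_ (suc w * N)) (+-identityʳ _) ⟨
      2 * (suc w * N)        ∎
    avoids : Avoids {2 + e} {n} {k} (cylinder e (antidiagonal N w A)) graph
    avoids contains =
      let σ , τ , σ↑ , τ↑ , one = contains-cylinder (antidiagonal N w A) contains
      in gridless (grid N w A σ τ σ↑ τ↑ one)

-- Rational bounds for the cuts.

fromℕ : ℕ → ℚᵘ
fromℕ m = ℤ.+ m ℚ./ 1

fromℕ-mono-≤ : ∀ {m n} → m ≤ n → fromℕ m ℚ.≤ fromℕ n
fromℕ-mono-≤ m≤n = *≤* (ℤ.*-monoʳ-≤-nonNeg (ℤ.+ 1) (+≤+ m≤n))

fromℕ-* : ∀ m n → fromℕ m ℚ.* fromℕ n ≡ fromℕ (m * n)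
fromℕ-* m n = cong (λ i → mkℚᵘ i 0) (sym (ℤ.pos-* m n))

fromℕ-^-mono-≤ : ∀ m {q} → fromℕ m ℚ.≤ q → ∀ n → fromℕ (m ^ n) ℚ.≤ q ^ℚ n
fromℕ-^-mono-≤ m     m≤q zero    = ℚ.≤-refl
fromℕ-^-mono-≤ m {q} m≤q (suc n) = subst (ℚ._≤ q ℚ.* q ^ℚ n) (fromℕ-* m (m ^ n))
  (ℚ.*-mono-≤-nonNeg {fromℕ m} {q} {fromℕ (m ^ n)} {q ^ℚ n} m≤q (fromℕ-^-mono-≤ m m≤q n))

-- An s above m would have a d-th power of at least m^d, hence of at least k.
root≤ : ∀ {d k} m {s} → k ≤ m ^ d → root d k s → s ℚ.≤ fromℕ m
root≤ m k≤m^d (inj₁ s<0) = ℚ.≤-trans (ℚ.<⇒≤ s<0) (fromℕ-mono-≤ {0} z≤n)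
root≤ {d} m {s} k≤m^d (inj₂ s^d<k) with s ℚ.≤? fromℕ m
... | yes s≤m = s≤m
... | no  s≰m = contradiction
  (ℚ.<-≤-trans s^d<k (ℚ.≤-trans (fromℕ-mono-≤ k≤m^d) (fromℕ-^-mono-≤ m (ℚ.<⇒≤ (ℚ.≰⇒> s≰m)) d)))
  (ℚ.<-irrefl ℚ.≃-refl)

·root≤ : ∀ C .{{_ : NonZero C}} t {d k} r →
         k ≤ (C * t) ^ d → ((ℤ.+ 1 ℚ./ C) · root d k) r → r ℚ.≤ fromℕ t
·root≤ C@(suc C-1) t {d} r k≤ (s , s∈root , r<cs) = ℚ.<⇒≤ (ℚ.<-≤-trans r<cs (ℚ.≤-trans
  (ℚ.*-monoʳ-≤-nonNeg (ℤ.+ 1 ℚ./ C) (root≤ {d} (C * t) k≤ s∈root))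
  (ℚ.≤-reflexive (*≡* (eq (ℤ.+ C) (ℤ.+ t) (ℤ.pos-* C t))))))
  where
  eq : ∀ c t {ct} → ct ≡ c ℤ.* t → ℤ.+ 1 ℤ.* ct ℤ.* ℤ.+ 1 ≡ t ℤ.* (c ℤ.* ℤ.+ 1)
  eq c t refl = eq′ c t
    where
    eq′ : ∀ c t → ℤ.+ 1 ℤ.* (c ℤ.* t) ℤ.* ℤ.+ 1 ≡ t ℤ.* (c ℤ.* ℤ.+ 1)
    eq′ = ℤ.solve-∀

2^ℤ≤ : ∀ i m → i ℤ.≤ ℤ.+ m → 2^ℤ i ℚ.≤ fromℕ (2 ^ m)
2^ℤ≤ (ℤ.+ n)    m (+≤+ n≤m) = fromℕ-mono-≤ (^-monoʳ-≤ 2 n≤m)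
2^ℤ≤ -[1+ n ] m _         = lemma (2 ^ suc n) {{m^n≢0 2 (suc n)}} (m^n>0 2 m)
  where
  lemma : ∀ x .{{_ : NonZero x}} {y} → 0 < y → ℤ.+ 1 ℚ./ x ℚ.≤ fromℕ y
  lemma (suc x) {suc y} _ = *≤* (+≤+ (s≤s z≤n))

-- Write r = a/b, so that a ≤ t b. If q were at least 2^t, then q^b would be at least 2^(tb) and
-- thus at least 2^a.
exp₂< : ∀ q r t → r ℚ.≤ fromℕ t → q ^ℚ ↧ₙ r ℚ.< 2^ℤ (↥ r) → q ℚ.< fromℕ (2 ^ t)
exp₂< q r t (*≤* r≤t) q^b<2^a with q ℚ.<? fromℕ (2 ^ t)
... | yes q<2^t = q<2^t
... | no  q≮2^t = contradiction
  (ℚ.<-≤-trans q^b<2^a (ℚ.≤-trans (2^ℤ≤ (↥ r) (t * ↧ₙ r) a≤tb)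
    (subst (λ x → fromℕ x ℚ.≤ q ^ℚ ↧ₙ r) (^-*-assoc 2 t (↧ₙ r))
           (fromℕ-^-mono-≤ (2 ^ t) (ℚ.≮⇒≥ q≮2^t) (↧ₙ r)))))
  (ℚ.<-irrefl ℚ.≃-refl)
  where
  a≤tb : ↥ r ℤ.≤ ℤ.+ (t * ↧ₙ r)
  a≤tb = subst₂ ℤ._≤_ (ℤ.*-identityʳ (↥ r)) (sym (ℤ.pos-* t (↧ₙ r))) r≤t

fromℕ≤/ : ∀ a b c .{{_ : NonZero c}} → a * c ≤ b → fromℕ a ℚ.≤ ℤ.+ b ℚ./ c
fromℕ≤/ a b (suc c) ac≤b =
  *≤* (subst₂ ℤ._≤_ (ℤ.pos-* a (suc c)) (sym (ℤ.*-identityʳ (ℤ.+ b))) (+≤+ ac≤b))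

-- Choice of t for a given k, and assembly.

-- Selects t for a given k: the lower bound on k leaves room for the pattern with ℓ² cells, and the
-- upper bound keeps t of order at least √k.
bracket : ∀ (g : ℕ → ℕ) → (∀ t → g t < g (suc t)) → ∀ k → g 1 < k →
          ∃ λ t → 1 ≤ t × g t < k × k ≤ g (suc t)
bracket g g↑ (suc k) (s≤s g1≤k) with m≤n⇒m<n∨m≡n g1≤k
... | inj₂ refl = 1 , ≤-refl , ≤-refl , g↑ 1
... | inj₁ g1<k with bracket g g↑ k g1<k
...   | t , 1≤t , gt<k , k≤ with m≤n⇒m<n∨m≡n k≤
...     | inj₁ k<   = t , 1≤t , <-trans gt<k ≤-refl , k<
...     | inj₂ refl = suc t , s≤s z≤n , ≤-refl , g↑ (suc t)

groups² : ℕ → ℕ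
groups² t = groups t * groups t

groups²-increasing : ∀ t → groups² t < groups² (suc t)
groups²-increasing t = *-mono-< groups-increasing groups-increasing
  where
  groups-increasing : groups t < groups (suc t)
  groups-increasing =
    *-monoʳ-< 5 (*-monoʳ-< 2 (*-monoʳ-< 4 (*-monoʳ-< 4 (≤-refl {suc t}))))

-- As t + 1 ≤ 2 t, passing to the next value of `groups` at most doubles it, which gives the
-- constant `groups 2` = 320. Raising the exponent from 2 to d weakens √k to the d-th root of k.
groups²≤ : ∀ t d → 1 ≤ t → 2 ≤ d → groups² (suc t) ≤ (groups 2 * t) ^ d
groups²≤ t d 1≤t 2≤d = begin
  groups² (suc t)                      ≤⟨ *-mono-≤ doubling doubling ⟩
  groups 2 * t * (groups 2 * t)        ≡⟨ cong (groups 2 * t *_) (*-identityʳ _) ⟨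
  (groups 2 * t) ^ 2                   ≤⟨ ^-monoʳ-≤ (groups 2 * t) {{320t≢0}} 2≤d ⟩
  (groups 2 * t) ^ d                   ∎
  where
  open ≤-Reasoning
  eq : ∀ a b c d e t → a * (b * (c * (d * (e * t)))) ≡ a * (b * (c * (d * e))) * t
  eq = solve-∀
  320t≢0 : NonZero (groups 2 * t)
  320t≢0 = m*n≢0 (groups 2) t {{_}} {{>-nonZero 1≤t}}
  doubling : groups (suc t) ≤ groups 2 * t
  doubling = begin
    groups (suc t)  ≤⟨ *-monoʳ-≤ 5 (*-monoʳ-≤ 2 (*-monoʳ-≤ 4 (*-monoʳ-≤ 4 (+-monoˡ-≤ t 1≤t)))) ⟩
    groups (t + t)  ≡⟨ eq′ t ⟩
    5 * (2 * (4 * (4 * (2 * t)))) ≡⟨ eq 5 2 4 4 2 t ⟩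
    groups 2 * t    ∎
    where
    eq′ : ∀ t → 5 * (2 * (4 * (4 * (t + t)))) ≡ 5 * (2 * (4 * (4 * (2 * t))))
    eq′ = solve-∀

∈exp₂⇒<2^t : ∀ C .{{_ : NonZero C}} t {d k} q →
  k ≤ (C * t) ^ d → exp₂ ((ℤ.+ 1 ℚ./ C) · root d k) q → q ℚ.< fromℕ (2 ^ t)
∈exp₂⇒<2^t C t q k≤ (r , r∈ , inj₁ q<0)         = ℚ.<-≤-trans q<0 (fromℕ-mono-≤ {0} z≤n)
∈exp₂⇒<2^t C t {d} q k≤ (r , r∈ , inj₂ q^b<2^a) = exp₂< q r t (·root≤ C t {d} r k≤ r∈) q^b<2^a

-- The constant K itself is the eventual lower bound that `liminf` asks for.
≼I : ∀ {x : Cut} {e k} (P : Matrix (2 + e) k) K N → (∀ q → x q → q ℚ.< fromℕ K) →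
     (∀ n → N ≤ n → K * n ^ suc e ≤ f {2 + e} n P) → x ≼ I {2 + e} P
≼I {e = e} P K N x<K K≤f q q∈x =
  fromℕ K , x<K q q∈x , N ,
  λ n N≤n → fromℕ≤/ K (f {2 + e} n P) (n ^ suc e) {{m^n≢0 n (suc e)}} (K≤f n N≤n)

HasFamily : (e k : ℕ) → Cut → Set₁
HasFamily e k x =
  ∃ λ (𝓕 : Pred (Matrix (2 + e) k) 0ℓ) → Satisfiable 𝓕 ×
    (∀ P → P Unary.∈ 𝓕 → IsPermutation {2 + e} P × x ≼ I {2 + e} P)

singleton-family : ∀ {e k x} (P : Matrix (2 + e) k) →
  IsPermutation {2 + e} P → x ≼ I {2 + e} P → HasFamily e k x
singleton-family P perm x≼I = (_≡ P) , (P , refl) , λ { _ refl → perm , x≼I }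

family : ∀ e ℓ K N {x : Cut} .{{_ : NonZero N}} → Gridless ℓ K N →
  (∀ q → x q → q ℚ.< fromℕ K) → ∀ {k} → ℓ * ℓ < k → HasFamily e k x
family e ℓ K N {x} gridless x<K {k} ℓ²<k =
  -- The number o of padding points is k - ℓ² - 1.
  let o , eq = m≤n⇒∃[o]m+o≡n ℓ²<k in subst (λ k → HasFamily e k x) eq (transposed o)
  where
  module _ (o : ℕ) where
    module T = Transposition ℓ o
    module G = Graph T.transpose T.transpose-involutive e
    lower : x ≼ I {2 + e} {T.k} G.graph
    lower = ≼I {x} {e} {T.k} G.graph K N x<K (f-graph≥ ℓ o e K N gridless)
    perm : IsPermutation {2 + e} {T.k} G.graph
    perm = G.isPermutation
    transposed : HasFamily e T.k x
    transposed = singleton-family {e} {T.k} {x} G.graph perm lower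

theorem4p6 : ∀ d → 2 ≤ d →
    ∃ λ (c : ℚᵘ) → 0ℚᵘ ℚ.< c ×
    ∃ λ (k₀ : ℕ) →
    ∀ k → k₀ ≤ k →
    ∃ λ (𝓕 : Pred (Matrix d k) 0ℓ) →
    Satisfiable 𝓕 ×
    (∀ P → P Unary.∈ 𝓕 → IsPermutation P × exp₂ (c · root d k) ≼ I P)
theorem4p6 (suc zero)    (s≤s ())
theorem4p6 (suc (suc e)) 2≤d =
  -- The constant is c = 1/320, and the threshold 160² + 1 ensures t ≥ 1 in `bracket`.
  ℤ.+ 1 ℚ./ groups 2 , *<* (ℤ.+<+ z<s) , suc (groups² 1) , λ k k₀≤k →
    let t , 1≤t , ℓ²<k , k≤ = bracket groups² groups²-increasing k k₀≤k
    in family e (groups t) (2 ^ t) (side t) {{m^n≢0 2 (4 * t)}} (∃-gridless t {{>-nonZero 1≤t}})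
         (λ q → ∈exp₂⇒<2^t (groups 2) t {2 + e} q (≤-trans k≤ (groups²≤ t (2 + e) 1≤t 2≤d))) ℓ²<k
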